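{- Let $\mathfrak{R}$ be either a finite field $\mathbb{F}_q$ or the ring $\mathbb{Z}_k$ ($k\ge 2$), with elements listed as $0=\omega_0,\omega_1,\ldots,\omega_{|\mathfrak{R}|-1}$. Let $C$ be an $\mathfrak{R}$-linear code of length $n$ and $\bm{w}\in\mathfrak{R}^n$. Then \[ Jac^{av}(C,\bm{w}; x_a : a\in\mathfrak{R}^2) =\sum_{L,R} A_L^C\, \frac{\prod_{b\in\mathfrak{R}}\dbinom{\ell_b(\bm{w})}{R_{(\omega_0, b)},\ldots,R_{(\omega_{|\mathfrak{R}|-1}, b)}}}{\dbinom{n}{L_{\omega_0},\ldots,L_{\omega_{|\mathfrak{R}|-1}}}} \prod_{a\in\mathfrak{R}^2} x_a^{R_a}, \] where the sum runs over all pairs $(L,R)$ with $L$ a composition of $n$ and $R$ a Jacobi composition of $n$ such that $L_c=\sum_{b\in\mathfrak{R}} R_{(c,b)}$ for every $c\in\mathfrak{R}$ and $\ell_c(\bm{w})=\sum_{b\in\mathfrak{R}} R_{(b,c)}$ for every $c\in\mathfrak{R}$.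
   Context: $\mathfrak{R}$ denotes either the finite field $\mathbb{F}_q$ or the ring $\mathbb{Z}_k$ of integers modulo $k\ge2$. An $\mathfrak{R}$-linear code of length $n$ is an $\mathbb{F}_q$-subspace of $\mathbb{F}_q^n$ or an additive subgroup of $\mathbb{Z}_k^n$, respectively. For $\bm{u}\in\mathfrak{R}^n$ and $c\in\mathfrak{R}$, $\ell_c(\bm{u})$ is the number of coordinates of $\bm{u}$ equal to $c$; the composition of $\bm{u}$ is $(\ell_c(\bm{u}) : c\in\mathfrak{R})$. A composition $L$ of $n$ is a vector $(L_c : c\in\mathfrak{R})$ of non-negative integers summing to $n$; a Jacobi composition $R$ of $n$ is a vector $(R_a : a\in\mathfrak{R}^2)$ of non-negative integers summing to $n$. $A_L^C$ is the number of $\bm{u}\in C$ with composition $L$. For $\bm{u},\bm{w}\in\mathfrak{R}^n$ and $a\in\mathfrak{R}^2$, $r_a(\bm{u};\bm{w})=\#\{i : (u_i,w_i)=a\}$. The complete Jacobi polynomial of $C$ with respect to $\bm{w}$ is $Jac(C,\bm{w}; x_a : a\in\mathfrak{R}^2)=\sum_{\bm{u}\in C}\prod_{a\in\mathfrak{R}^2} x_a^{r_a(\bm{u};\bm{w})}$. For a permutation $\sigma$ in the symmetric group $S_n$, $\bm{u}^\sigma=(u_{\sigma(1)},\ldots,u_{\sigma(n)})$ and $C^\sigma=\{\bm{u}^\sigma : \bm{u}\in C\}$. The average Jacobi polynomial is $Jac^{av}(C,\bm{w}; x_a : a\in\mathfrak{R}^2)=\frac{1}{n!}\sum_{\sigma\in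 S_n} Jac(C^\sigma,\bm{w}; x_a : a\in\mathfrak{R}^2)$. The multinomial coefficient is $\binom{m}{m_1,\ldots,m_k}=\frac{m!}{m_1!\cdots m_k!}$. -}

module Defs where

open import Data.Nat as ℕ using (ℕ; zero; suc; _≤_; _!; NonZero)
import Data.Nat.Properties as ℕP
open import Data.Nat.DivMod using (_mod_)
open import Data.Fin as Fin using (Fin; toℕ)
open import Data.Fin.Properties using (all?) renaming (_≟_ to _≟F_)
open import Data.Vec as Vec using (Vec; []; _∷_; lookup; tabulate)
open import Data.Vec.Properties using (≡-dec)
open import Data.List as List using (List; concatMap)
open import Data.Integer using (+_)
open import Data.Rational as ℚ using (ℚ; 0ℚ; 1ℚ; _/_; 1/_)
import Data.Rational.Properties as ℚP
open import Data.Product using (Σ; ∃; _×_; _,_; proj₁; proj₂)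
open import Data.Bool using (Bool; true; false; _∧_; T)
open import Data.Bool.ListAction using (any)
open import Relation.Nullary using (Dec; yes; no; does; ¬_)
open import Relation.Nullary.Decidable using (_×-dec_; _→-dec_; T?)
open import Relation.Binary.PropositionalEquality using (_≡_; _≢_)
open import Algebra.Structures using (IsCommutativeRing)

-- The alphabet 𝔑 : a finite field F_q or Z_k (k ≥ 2).
-- In both cases the carrier is Fin m (m = |𝔑|); the element ω_i is i.

record FiniteField : Set where
  field
    q    : ℕ
    _+_  : Fin q → Fin q → Fin q
    _*_  : Fin q → Fin q → Fin q
    -_   : Fin q → Fin q
    0#   : Fin q
    1#   : Fin q
    isCommutativeRing : IsCommutativeRing _≡_ _+_ _*_ -_ 0# 1#
    0≢1     : 0# ≢ 1#
    inverse : ∀ x → x ≢ 0# → ∃ λ y → (x * y) ≡ 1#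

data Alphabet : Set where
  𝔽_  : FiniteField → Alphabet
  ℤ/_,_ : (k : ℕ) → 2 ≤ k → Alphabet

size : Alphabet → ℕ
size (𝔽 F)     = FiniteField.q F
size (ℤ/ k , _) = k

addℤ : (k : ℕ) → Fin k → Fin k → Fin k
addℤ (suc k) a b = (toℕ a ℕ.+ toℕ b) mod (suc k)

negℤ : (k : ℕ) → Fin k → Fin k
negℤ (suc k) a = (suc k ℕ.∸ toℕ a) mod (suc k)

Word : ℕ → ℕ → Set
Word m n = Vec (Fin m) n

Code : ℕ → ℕ → Set
Code m n = Word m n → Bool

_∈C_ : ∀ {m n} → Word m n → Code m n → Set
u ∈C C = T (C u)

IsLinear : (𝔄 : Alphabet) (n : ℕ) → Code (size 𝔄) n → Set
IsLinear (𝔽 F) n C =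
  (Vec.replicate n 0# ∈C C)
  × (∀ u v → u ∈C C → v ∈C C → Vec.zipWith _+_ u v ∈C C)
  × (∀ c u → u ∈C C → Vec.map (c *_) u ∈C C)
  where open FiniteField F
IsLinear (ℤ/ k , 2≤k) n C =
  (Vec.replicate n (Fin.fromℕ< k>0) ∈C C)
  × (∀ u v → u ∈C C → v ∈C C → Vec.zipWith (addℤ k) u v ∈C C)
  × (∀ u → u ∈C C → Vec.map (negℤ k) u ∈C C)
  where
  k>0 : 0 ℕ.< k
  k>0 = ℕP.<-≤-trans (ℕ.s≤s ℕ.z≤n) 2≤k

allVecs : ∀ {A : Set} → List A → (n : ℕ) → List (Vec A n)
allVecs xs zero    = List.[ [] ]
allVecs xs (suc n) = concatMap (λ x → List.map (x ∷_) (allVecs xs n)) xs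

allWords : (m n : ℕ) → List (Word m n)
allWords m n = allVecs (List.allFin m) n

IsPerm : ∀ {n} → Vec (Fin n) n → Set
IsPerm {n} σ = ∀ i j → lookup σ i ≡ lookup σ j → i ≡ j

isPerm? : ∀ {n} (σ : Vec (Fin n) n) → Dec (IsPerm σ)
isPerm? σ = all? (λ i → all? (λ j → (lookup σ i ≟F lookup σ j) →-dec (i ≟F j)))

Sym : (n : ℕ) → List (Vec (Fin n) n)
Sym n = List.filter isPerm? (allVecs (List.allFin n) n)

_^_ : ∀ {m n} → Word m n → Vec (Fin n) n → Word m n
u ^ σ = tabulate (λ i → lookup u (lookup σ i))

_^C_ : ∀ {m n} → Code m n → Vec (Fin n) n → Code m n
_^C_ {m} {n} C σ v =
  any (λ u → C u ∧ does (≡-dec _≟F_ (u ^ σ) v)) (allWords m n)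

ℓ : ∀ {m n} → Fin m → Word m n → ℕ
ℓ c u = Vec.count (λ x → x ≟F c) u

comp : ∀ {m n} → Word m n → Vec ℕ m
comp u = tabulate (λ c → ℓ c u)

-- a Jacobi composition / exponent vector (R_a : a ∈ 𝔑²), with
-- R_(a₁,a₂) = lookup (lookup R a₁) a₂
JExp : ℕ → Set
JExp m = Vec (Vec ℕ m) m

R_ : ∀ {m} → JExp m → Fin m → Fin m → ℕ
R_ R a₁ a₂ = lookup (lookup R a₁) a₂

r : ∀ {m n} → Fin m → Fin m → Word m n → Word m n → ℕ
r {n = n} a₁ a₂ u w =
  Vec.count (λ i → (lookup u i ≟F a₁) ×-dec (lookup w i ≟F a₂)) (Vec.allFin n)

rvec : ∀ {m n} → Word m n → Word m n → JExp m
rvec u w = tabulate (λ a₁ → tabulate (λ a₂ → r a₁ a₂ u w))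

Compositions : (m n : ℕ) → List (Vec ℕ m)
Compositions m n =
  List.filter (λ L → Vec.sum L ℕP.≟ n) (allVecs (List.upTo (suc n)) m)

JacobiCompositions : (m n : ℕ) → List (JExp m)
JacobiCompositions m n =
  List.filter (λ R → Vec.sum (Vec.map Vec.sum R) ℕP.≟ n)
              (allVecs (allVecs (List.upTo (suc n)) m) m)

A : ∀ {m n} → Code m n → Vec ℕ m → ℕ
A {m} {n} C L =
  List.length (List.filter (λ u → T? (C u) ×-dec ≡-dec ℕP._≟_ (comp u) L)
                           (allWords m n))

-- Formal polynomials over ℚ in the variables x_a (a ∈ 𝔑²):
-- a finite list of terms (coefficient , exponent vector).

Poly : ℕ → Set
Poly m = List (ℚ × JExp m)

coeff : ∀ {m} → Poly m → JExp m → ℚ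
coeff p E = List.foldr ℚ._+_ 0ℚ
  (List.map proj₁ (List.filter (λ t → ≡-dec (≡-dec ℕP._≟_) (proj₂ t) E) p))

_≈P_ : ∀ {m} → Poly m → Poly m → Set
p ≈P p' = ∀ E → coeff p E ≡ coeff p' E

scale : ∀ {m} → ℚ → Poly m → Poly m
scale c = List.map (λ t → (c ℚ.* proj₁ t , proj₂ t))

Jac : ∀ {m n} → Code m n → Word m n → Poly m
Jac {m} {n} C w =
  List.map (λ u → (1ℚ , rvec u w)) (List.filter (λ u → T? (C u)) (allWords m n))

Jacav : ∀ {m n} → Code m n → Word m n → Poly m
Jacav {m} {n} C w =
  scale ((+ 1 / (n !)) {{ℕP._!≢0 n}}) (concatMap (λ σ → Jac (C ^C σ) w) (Sym n))

prodFact : ∀ {k} → Vec ℕ k → ℕ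
prodFact ls = Vec.foldr _ ℕ._*_ 1 (Vec.map _! ls)

prodFact≢0 : ∀ {k} (ls : Vec ℕ k) → NonZero (prodFact ls)
prodFact≢0 []       = _
prodFact≢0 (l ∷ ls) = ℕP.m*n≢0 (l !) (prodFact ls) {{ℕP._!≢0 l}} {{prodFact≢0 ls}}

multinomial : ∀ {k} → ℕ → Vec ℕ k → ℚ
multinomial M ls = (+ (M !) / prodFact ls) {{prodFact≢0 ls}}

multinomial≢0 : ∀ {k} M (ls : Vec ℕ k) → ℚ.NonZero (multinomial M ls)
multinomial≢0 M ls =
  ℚP.pos⇒nonZero (multinomial M ls) {{ℚP.normalize-pos (M !) (prodFact ls) {{prodFact≢0 ls}} {{ℕP._!≢0 M}}}}

prodℚ : ∀ {m} → (Fin m → ℚ) → ℚ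
prodℚ {m} f = List.foldr ℚ._*_ 1ℚ (List.map f (List.allFin m))

Compatible : ∀ {m n} → Word m n → Vec ℕ m → JExp m → Set
Compatible {m} w L R =
  (L ≡ tabulate (λ c → Vec.sum (tabulate (λ b → (R_ R) c b))))
  × (comp w ≡ tabulate (λ c → Vec.sum (tabulate (λ b → (R_ R) b c))))

compatible? : ∀ {m n} (w : Word m n) L R → Dec (Compatible w L R)
compatible? w L R = ≡-dec ℕP._≟_ _ _ ×-dec ≡-dec ℕP._≟_ _ _

rhsCoeff : ∀ {m n} → Code m n → Word m n → Vec ℕ m → JExp m → ℚ
rhsCoeff {m} {n} C w L R =
  (+ A C L / 1) ℚ.*
  prodℚ (λ b → multinomial (ℓ b w) (tabulate (λ i → (R_ R) i b))) ℚ.*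
  (1/ multinomial n L) {{multinomial≢0 n L}}

RHS : ∀ {m n} → Code m n → Word m n → Poly m
RHS {m} {n} C w =
  concatMap (λ L →
    List.map (λ R → (rhsCoeff C w L R , R))
      (List.filter (compatible? w L) (JacobiCompositions m n)))
    (Compositions m n)

{-# OPTIONS --safe #-}

-- Compare coefficients of an exponent E = (E_(a,b)). Since u ↦ u^σ is injective on words, the
-- coefficient of E in Σ_σ Jac(C^σ, w) is the number of pairs (u, σ) with u ∈ C and r(u^σ; w) = E.
-- No such pair exists unless the column sums of E are the ℓ_b(w) and its row sums L_a the
-- composition of u. In that case the number N of suitable σ for a fixed u satisfies
--     N · ∏_{a,b} E_(a,b)! = ∏_b ℓ_b(w)! · ∏_a L_a!.
-- This is proved by induction on the length of w, choosing the values of σ one by one among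
-- the positions of u that are still free: if w starts with y and σ starts with a position of
-- letter x, then E_(x,y), L_x and ℓ_y(w) all drop by one; there are L_x such positions, and
-- Σ_x E_(x,y) = ℓ_y(w).

module Submission where

open import Defs
open import Data.Nat using (ℕ)

open import Algebra.Core using (Op₂)
open import Algebra.Structures using (IsCommutativeRing; IsCommutativeSemiring)
open import Data.Bool using (Bool; true; false; _∧_; not; if_then_else_)
import Data.Bool.Properties as BoolP
open import Data.Bool.ListAction using (any)
open import Data.Empty using (⊥-elim)
open import Data.Fin as Fin using (Fin; zero; suc)
open import Data.Fin.Properties using (all?; any?; punchOut-injective; <⇒notInjective; suc-injective)
  renaming (_≟_ to _≟F_)
import Data.Integer as ℤ
import Data.Integer.Properties as ℤP
open import Data.List as List using (List; []; _∷_; allFin; concatMap; filter; map; foldr)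
import Data.List.Properties as ListP
open import Data.List.Membership.Propositional using (_∈_)
import Data.List.Membership.Propositional.Properties as ∈P
open import Data.List.Relation.Unary.All as All using ([])
open import Data.List.Relation.Unary.AllPairs using ([]; _∷_)
open import Data.List.Relation.Unary.Any using (here; there)
open import Data.List.Relation.Unary.Unique.Propositional using (Unique)
import Data.List.Relation.Unary.Unique.Propositional.Properties as UniqueP
open import Data.Nat using (zero; suc; _+_; _*_; _∸_; _!; _≤_; s≤s; NonZero)
import Data.Nat.Properties as ℕP
open import Data.Nat.Tactic.RingSolver using (solve-∀)
open import Data.Product using (∃; _×_; _,_; proj₁; proj₂)
open import Data.Rational as ℚ using (ℚ; 0ℚ; 1ℚ; _/_; 1/_)
import Data.Rational.Properties as ℚP
open import Data.Rational.Solver using (module +-*-Solver)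
import Data.Rational.Unnormalised as ℚᵘ
open import Data.Rational.Unnormalised using (mkℚᵘ; *≡*)
import Data.Rational.Unnormalised.Properties as ℚᵘP
open import Data.Vec as Vec using (Vec; []; _∷_; lookup; tabulate)
import Data.Vec.Properties as VecP
open import Function using (_∘_; id; const)
open import Function.Bundles using (mk⇔)
open import Relation.Binary.PropositionalEquality
open import Relation.Nullary using (Dec; yes; no; does; ¬_; contradiction)
open import Relation.Nullary.Decidable using (dec-true; dec-false; does-⇔; _×-dec_; T?)
open import Relation.Unary using (Decidable)
open ≡-Reasoning

private variable
  X Y : Set
  k m n : ℕ

-- Finite sums over lists.

module ListSum {S : Set} {_+_ _*_ : Op₂ S} {0# 1# : S}
  (isCommutativeSemiring : IsCommutativeSemiring _≡_ _+_ _*_ 0# 1#) where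

  open IsCommutativeSemiring isCommutativeSemiring
    using (+-identityˡ; +-identityʳ; +-assoc; +-comm; *-identityˡ; zeroˡ; zeroʳ; distribˡ; *-comm)

  -- The semiring is arbitrary because occurrences are counted in `ℕ` while coefficients lie in `ℚ`.
  -- The shape `foldr` after `map` is that of `coeff`, so a coefficient is such a sum by definition.
  ∑ : List X → (X → S) → S
  ∑ xs f = foldr _+_ 0# (map f xs)

  ⟦_⟧ : Bool → S
  ⟦ b ⟧ = if b then 1# else 0#

  ⟦∧⟧ : ∀ b c → ⟦ b ∧ c ⟧ ≡ ⟦ b ⟧ * ⟦ c ⟧
  ⟦∧⟧ true  c = sym (*-identityˡ _)
  ⟦∧⟧ false c = sym (zeroˡ _)

  ∑-agree : (xs : List X) {f g : X → S} → (∀ {x} → x ∈ xs → f x ≡ g x) → ∑ xs f ≡ ∑ xs g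
  ∑-agree []       f≗g = refl
  ∑-agree (x ∷ xs) f≗g = cong₂ _+_ (f≗g (here refl)) (∑-agree xs (f≗g ∘ there))

  ∑-cong : (xs : List X) {f g : X → S} → (∀ x → f x ≡ g x) → ∑ xs f ≡ ∑ xs g
  ∑-cong xs f≗g = cong (foldr _+_ 0#) (ListP.map-cong f≗g xs)

  ∑-zero : (xs : List X) {f : X → S} → (∀ {x} → x ∈ xs → f x ≡ 0#) → ∑ xs f ≡ 0#
  ∑-zero []       f≗0 = refl
  ∑-zero (x ∷ xs) f≗0 =
    trans (cong₂ _+_ (f≗0 (here refl)) (∑-zero xs (f≗0 ∘ there))) (+-identityˡ 0#)

  ∑-++ : (xs ys : List X) (f : X → S) → ∑ (xs List.++ ys) f ≡ ∑ xs f + ∑ ys f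
  ∑-++ []       ys f = sym (+-identityˡ _)
  ∑-++ (x ∷ xs) ys f = trans (cong (f x +_) (∑-++ xs ys f)) (sym (+-assoc _ _ _))

  ∑-map : (g : X → Y) (xs : List X) (f : Y → S) → ∑ (map g xs) f ≡ ∑ xs (f ∘ g)
  ∑-map g xs f = cong (foldr _+_ 0#) (sym (ListP.map-∘ xs))

  ∑-concatMap : (g : X → List Y) (xs : List X) (f : Y → S) →
    ∑ (concatMap g xs) f ≡ ∑ xs (λ x → ∑ (g x) f)
  ∑-concatMap g []       f = refl
  ∑-concatMap g (x ∷ xs) f =
    trans (∑-++ (g x) (concatMap g xs) f) (cong (∑ (g x) f +_) (∑-concatMap g xs f))

  ∑-filter : {P : X → Set} (P? : Decidable P) (xs : List X) (f : X → S) →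
    ∑ (filter P? xs) f ≡ ∑ xs (λ x → ⟦ does (P? x) ⟧ * f x)
  ∑-filter P? []       f = refl
  ∑-filter P? (x ∷ xs) f with does (P? x)
  ... | true  = cong₂ _+_ (sym (*-identityˡ _)) (∑-filter P? xs f)
  ... | false = trans (∑-filter P? xs f)
                  (sym (trans (cong (_+ ∑ xs (λ y → ⟦ does (P? y) ⟧ * f y)) (zeroˡ (f x))) (+-identityˡ _)))

  ∑-+ : (xs : List X) (f g : X → S) → ∑ xs (λ x → f x + g x) ≡ ∑ xs f + ∑ xs g
  ∑-+ []       f g = sym (+-identityˡ _)
  ∑-+ (x ∷ xs) f g = begin
    (f x + g x) + ∑ xs (λ x → f x + g x)  ≡⟨ cong ((f x + g x) +_) (∑-+ xs f g) ⟩
    (f x + g x) + (∑ xs f + ∑ xs g)       ≡⟨ +-assoc _ _ _ ⟩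
    f x + (g x + (∑ xs f + ∑ xs g))       ≡⟨ cong (f x +_) (+-assoc _ _ _) ⟨
    f x + ((g x + ∑ xs f) + ∑ xs g)       ≡⟨ cong (λ s → f x + (s + ∑ xs g)) (+-comm _ _) ⟩
    f x + ((∑ xs f + g x) + ∑ xs g)       ≡⟨ cong (f x +_) (+-assoc _ _ _) ⟩
    f x + (∑ xs f + (g x + ∑ xs g))       ≡⟨ +-assoc _ _ _ ⟨
    (f x + ∑ xs f) + (g x + ∑ xs g)       ∎

  ∑-*ˡ : (c : S) (xs : List X) (f : X → S) → ∑ xs (λ x → c * f x) ≡ c * ∑ xs f
  ∑-*ˡ c []       f = sym (zeroʳ c)
  ∑-*ˡ c (x ∷ xs) f = trans (cong ((c * f x) +_) (∑-*ˡ c xs f)) (sym (distribˡ _ _ _))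

  ∑-*ʳ : (c : S) (xs : List X) (f : X → S) → ∑ xs (λ x → f x * c) ≡ ∑ xs f * c
  ∑-*ʳ c xs f = trans (∑-cong xs (λ _ → *-comm _ _)) (trans (∑-*ˡ c xs f) (*-comm _ _))

  ∑-swap : (xs : List X) (ys : List Y) (f : X → Y → S) →
    ∑ xs (λ x → ∑ ys (f x)) ≡ ∑ ys (λ y → ∑ xs (λ x → f x y))
  ∑-swap []       ys f = sym (∑-zero ys (λ _ → refl))
  ∑-swap (x ∷ xs) ys f = trans (cong (∑ ys (f x) +_) (∑-swap xs ys f))
                               (sym (∑-+ ys (f x) (λ y → ∑ xs (λ x → f x y))))

  -- Uniqueness of the list ensures that `a` is met exactly once. Sums against a Kronecker delta are
  -- collapsed this way throughout.
  ∑-single : {xs : List X} {a : X} {f : X → S} → Unique xs → a ∈ xs →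
    (∀ x → x ≢ a → f x ≡ 0#) → ∑ xs f ≡ f a
  ∑-single {xs = x ∷ xs} (x∉ ∷ _) (here refl) f≗0 =
    trans (cong (_ +_) (∑-zero xs (λ y∈ → f≗0 _ (λ { refl → All.lookup x∉ y∈ refl }))))
          (+-identityʳ _)
  ∑-single (x∉ ∷ uniq) (there a∈) f≗0 =
    trans (cong₂ _+_ (f≗0 _ (λ { refl → All.lookup x∉ a∈ refl })) (∑-single uniq a∈ f≗0))
          (+-identityˡ _)

open ListSum ℕP.+-*-isCommutativeSemiring

-- Products and factorials.

∏ : List X → (X → ℕ) → ℕ
∏ xs f = foldr _*_ 1 (map f xs)

∏-cong : (xs : List X) {f g : X → ℕ} → (∀ x → f x ≡ g x) → ∏ xs f ≡ ∏ xs g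
∏-cong xs f≗g = cong (foldr _*_ 1) (ListP.map-cong f≗g xs)

∏-agree : (xs : List X) {f g : X → ℕ} → (∀ {x} → x ∈ xs → f x ≡ g x) → ∏ xs f ≡ ∏ xs g
∏-agree []       f≗g = refl
∏-agree (x ∷ xs) f≗g = cong₂ _*_ (f≗g (here refl)) (∏-agree xs (f≗g ∘ there))

∏-one : (xs : List X) {f : X → ℕ} → (∀ x → f x ≡ 1) → ∏ xs f ≡ 1
∏-one []       f≗1 = refl
∏-one (x ∷ xs) f≗1 = cong₂ _*_ (f≗1 x) (∏-one xs f≗1)

-- In a list without repetition exactly one factor is affected, so its change passes to the whole
-- product.
∏-update : ∀ {xs : List X} {a} {f g : X → ℕ} (c : ℕ) → Unique xs → a ∈ xs →
  f a ≡ c * g a → (∀ x → x ≢ a → f x ≡ g x) → ∏ xs f ≡ c * ∏ xs g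
∏-update {xs = _ ∷ xs} c (x∉ ∷ _) (here refl) at off =
  trans (cong₂ _*_ at (∏-agree xs (λ y∈ → off _ (λ { refl → All.lookup x∉ y∈ refl }))))
        (ℕP.*-assoc c _ _)
∏-update {xs = x ∷ xs} {g = g} c (x∉ ∷ uniq) (there a∈) at off =
  trans (cong₂ _*_ (off _ (λ { refl → All.lookup x∉ a∈ refl })) (∏-update c uniq a∈ at off))
        (lemma (g x) c (∏ xs g))
  where
  lemma : ∀ a b c → a * (b * c) ≡ b * (a * c)
  lemma = solve-∀

does-refl : (i : Fin m) → does (i ≟F i) ≡ true
does-refl i = dec-true (i ≟F i) refl

does-≢ : {i j : Fin m} → i ≢ j → does (i ≟F j) ≡ false
does-≢ i≢j = dec-false (_ ≟F _) i≢j

∑-singleF : {f : Fin m → ℕ} (a : Fin m) → (∀ x → x ≢ a → f x ≡ 0) → ∑ (allFin m) f ≡ f a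
∑-singleF {m} a = ∑-single (UniqueP.allFin⁺ m) (∈P.∈-allFin a)

-- Here `f` exceeds `g` by one at `x` and nowhere else, and there `f x !` is `f x * g x !`.
∏-!-step : {x : Fin m} {f g : Fin m → ℕ} → (∀ c → f c ≡ ⟦ does (x ≟F c) ⟧ + g c) →
  ∏ (allFin m) (λ c → f c !) ≡ f x * ∏ (allFin m) (λ c → g c !)
∏-!-step {m} {x} {f} {g} step = ∏-update (f x) (UniqueP.allFin⁺ m) (∈P.∈-allFin x) at off
  where
  fx : f x ≡ suc (g x)
  fx = trans (step x) (cong (λ b → ⟦ b ⟧ + g x) (does-refl x))
  at : f x ! ≡ f x * g x !
  at = trans (cong _! fx) (cong (_* g x !) (sym fx))
  off : ∀ c → c ≢ x → f c ! ≡ g c !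
  off c c≢x = cong _! (trans (step c) (cong (λ b → ⟦ b ⟧ + g c) (does-≢ (c≢x ∘ sym))))

-- Letter counts and pair counts.

ℓ-∷ : (c x : Fin m) (u : Word m n) → ℓ c (x ∷ u) ≡ ⟦ does (x ≟F c) ⟧ + ℓ c u
ℓ-∷ c x u with does (x ≟F c)
... | true  = refl
... | false = refl

-- `r` counts over `Vec.allFin`, whose tail is a tabulation of successors. Moving the successor into
-- the predicate gives the count for the tails of the two words.
count-tabulate : {P : Y → Set} (P? : Decidable P) (f : X → Y) (g : Fin n → X) →
  Vec.count P? (tabulate (f ∘ g)) ≡ Vec.count (λ x → P? (f x)) (tabulate g)
count-tabulate {n = zero}  P? f g = refl
count-tabulate {n = suc n} P? f g with does (P? (f (g zero)))
... | true  = cong suc (count-tabulate P? f (g ∘ suc))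
... | false = count-tabulate P? f (g ∘ suc)

r-∷ : (a b x y : Fin m) (u w : Word m n) →
  r a b (x ∷ u) (y ∷ w) ≡ ⟦ does (x ≟F a) ∧ does (y ≟F b) ⟧ + r a b u w
r-∷ a b x y u w with does (x ≟F a) ∧ does (y ≟F b)
... | true  = cong suc (count-tabulate (λ i → (lookup (x ∷ u) i ≟F a) ×-dec (lookup (y ∷ w) i ≟F b)) Fin.suc id)
... | false = count-tabulate (λ i → (lookup (x ∷ u) i ≟F a) ×-dec (lookup (y ∷ w) i ≟F b)) Fin.suc id

∑-∧ʳ : (b : Bool) (y : Fin m) → ∑ (allFin m) (λ c → ⟦ b ∧ does (y ≟F c) ⟧) ≡ ⟦ b ⟧
∑-∧ʳ b y = trans
  (∑-singleF y (λ c c≢y → cong ⟦_⟧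
    (trans (cong (b ∧_) (does-≢ (c≢y ∘ sym))) (BoolP.∧-zeroʳ b))))
  (cong ⟦_⟧ (trans (cong (b ∧_) (does-refl y)) (BoolP.∧-identityʳ b)))

∑-∧ˡ : (b : Bool) (y : Fin m) → ∑ (allFin m) (λ c → ⟦ does (y ≟F c) ∧ b ⟧) ≡ ⟦ b ⟧
∑-∧ˡ {m} b y = trans (∑-cong (allFin m) (λ c → cong ⟦_⟧ (BoolP.∧-comm (does (y ≟F c)) b))) (∑-∧ʳ b y)

-- A position where `v` has `a` carries exactly one letter of `w`, so it is counted for exactly one
-- `b`.
∑-r-row : (v w : Word m n) (a : Fin m) → ∑ (allFin m) (λ b → r a b v w) ≡ ℓ a v
∑-r-row {m} []      []      a = ∑-zero (allFin m) (λ _ → refl)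
∑-r-row {m} (x ∷ v) (y ∷ w) a = begin
  ∑ (allFin m) (λ b → r a b (x ∷ v) (y ∷ w))
    ≡⟨ ∑-cong (allFin m) (λ b → r-∷ a b x y v w) ⟩
  ∑ (allFin m) (λ b → ⟦ does (x ≟F a) ∧ does (y ≟F b) ⟧ + r a b v w)
    ≡⟨ ∑-+ (allFin m) _ _ ⟩
  ∑ (allFin m) (λ b → ⟦ does (x ≟F a) ∧ does (y ≟F b) ⟧) + ∑ (allFin m) (λ b → r a b v w)
    ≡⟨ cong₂ _+_ (∑-∧ʳ (does (x ≟F a)) y) (∑-r-row v w a) ⟩
  ⟦ does (x ≟F a) ⟧ + ℓ a v
    ≡⟨ ℓ-∷ a x v ⟨
  ℓ a (x ∷ v) ∎

∑-r-column : (v w : Word m n) (b : Fin m) → ∑ (allFin m) (λ a → r a b v w) ≡ ℓ b w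
∑-r-column {m} []      []      b = ∑-zero (allFin m) (λ _ → refl)
∑-r-column {m} (x ∷ v) (y ∷ w) b = begin
  ∑ (allFin m) (λ a → r a b (x ∷ v) (y ∷ w))
    ≡⟨ ∑-cong (allFin m) (λ a → r-∷ a b x y v w) ⟩
  ∑ (allFin m) (λ a → ⟦ does (x ≟F a) ∧ does (y ≟F b) ⟧ + r a b v w)
    ≡⟨ ∑-+ (allFin m) _ _ ⟩
  ∑ (allFin m) (λ a → ⟦ does (x ≟F a) ∧ does (y ≟F b) ⟧) + ∑ (allFin m) (λ a → r a b v w)
    ≡⟨ cong₂ _+_ (∑-∧ˡ (does (y ≟F b)) x) (∑-r-column v w b) ⟩
  ⟦ does (y ≟F b) ⟧ + ℓ b w
    ≡⟨ ℓ-∷ b y w ⟨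
  ℓ b (y ∷ w) ∎

∑-ℓ : (w : Word m n) → ∑ (allFin m) (λ c → ℓ c w) ≡ n
∑-ℓ {m} []      = ∑-zero (allFin m) (λ _ → refl)
∑-ℓ {m} (y ∷ w) = begin
  ∑ (allFin m) (λ c → ℓ c (y ∷ w))
    ≡⟨ ∑-cong (allFin m) (λ c → ℓ-∷ c y w) ⟩
  ∑ (allFin m) (λ c → ⟦ does (y ≟F c) ⟧ + ℓ c w)
    ≡⟨ ∑-+ (allFin m) _ _ ⟩
  ∑ (allFin m) (λ c → ⟦ does (y ≟F c) ⟧) + ∑ (allFin m) (λ c → ℓ c w)
    ≡⟨ cong₂ _+_ (∑-∧ʳ true y) (∑-ℓ w) ⟩
  suc _ ∎

-- Sequences of free positions.

Realises : Word m n → Word m n → (Fin m → Fin m → ℕ) → Set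
Realises v w E = ∀ a b → r a b v w ≡ E a b

realises? : (v w : Word m n) (E : Fin m → Fin m → ℕ) → Dec (Realises v w E)
realises? v w E = all? (λ a → all? (λ b → r a b v w ℕP.≟ E a b))

delete : {N : ℕ} → Fin N → (Fin N → Bool) → Fin N → Bool
delete i free j = not (does (i ≟F j)) ∧ free j

-- These are the injective sequences inside `free`, in a form that follows the head-and-tail
-- enumeration of `allVecs`. The length `k` is independent of `N`: the induction shortens the
-- sequence but keeps the word `u`.
admissible : {N : ℕ} → (Fin N → Bool) → Vec (Fin N) k → Bool
admissible free []      = true
admissible free (i ∷ σ) = free i ∧ admissible (delete i free) σ

module _ {N : ℕ} (u : Word m N) where

  -- The number L_a of the outline in the middle of the choice of σ: it starts as `ℓ a u` and loses
  -- one whenever an `a` is used.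
  freeℓ : (Fin N → Bool) → Fin m → ℕ
  freeℓ free a = ∑ (allFin N) (λ i → ⟦ free i ∧ does (lookup u i ≟F a) ⟧)

  freeℓ-delete : (free : Fin N → Bool) (i : Fin N) → free i ≡ true → (a : Fin m) →
    freeℓ free a ≡ ⟦ does (lookup u i ≟F a) ⟧ + freeℓ (delete i free) a
  freeℓ-delete free i free-i a = begin
    ∑ (allFin N) (λ j → ⟦ free j ∧ does (lookup u j ≟F a) ⟧)
      ≡⟨ ∑-cong (allFin N) split ⟩
    ∑ (allFin N) (λ j → ⟦ does (i ≟F j) ∧ c j ⟧ + ⟦ delete i free j ∧ does (lookup u j ≟F a) ⟧)
      ≡⟨ ∑-+ (allFin N) _ _ ⟩
    ∑ (allFin N) (λ j → ⟦ does (i ≟F j) ∧ c j ⟧) + freeℓ (delete i free) a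
      ≡⟨ cong (_+ freeℓ (delete i free) a)
           (∑-singleF i (λ j j≢i → cong (λ d → ⟦ d ∧ c j ⟧) (does-≢ (j≢i ∘ sym)))) ⟩
    ⟦ does (i ≟F i) ∧ c i ⟧ + freeℓ (delete i free) a
      ≡⟨ cong₂ (λ d e → ⟦ d ∧ (e ∧ does (lookup u i ≟F a)) ⟧ + freeℓ (delete i free) a)
           (does-refl i) free-i ⟩
    ⟦ does (lookup u i ≟F a) ⟧ + freeℓ (delete i free) a ∎
    where
    c : Fin N → Bool
    c j = free j ∧ does (lookup u j ≟F a)
    split : ∀ j → ⟦ c j ⟧ ≡ ⟦ does (i ≟F j) ∧ c j ⟧ + ⟦ delete i free j ∧ does (lookup u j ≟F a) ⟧
    split j with does (i ≟F j)
    ... | true  = sym (ℕP.+-identityʳ _)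
    ... | false = refl

  -- The summand sees a position only through its letter, so positions may be grouped by letter.
  -- This is the source of the factor L_x in the outline.
  ∑-by-letter : (free : Fin N → Bool) (G : Fin m → ℕ) →
    ∑ (allFin N) (λ i → ⟦ free i ⟧ * G (lookup u i)) ≡ ∑ (allFin m) (λ a → freeℓ free a * G a)
  ∑-by-letter free G = begin
    ∑ (allFin N) (λ i → ⟦ free i ⟧ * G (lookup u i))
      -- Each summand is spread over all letters by an indicator, which allows the exchange of sums.
      ≡⟨ ∑-cong (allFin N) expand ⟨
    ∑ (allFin N) (λ i → ∑ (allFin m) (λ a → ⟦ free i ∧ does (lookup u i ≟F a) ⟧ * G a))
      ≡⟨ ∑-swap (allFin N) (allFin m) _ ⟩
    ∑ (allFin m) (λ a → ∑ (allFin N) (λ i → ⟦ free i ∧ does (lookup u i ≟F a) ⟧ * G a))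
      ≡⟨ ∑-cong (allFin m) (λ a → ∑-*ʳ (G a) (allFin N) _) ⟩
    ∑ (allFin m) (λ a → freeℓ free a * G a) ∎
    where
    expand : ∀ i → ∑ (allFin m) (λ a → ⟦ free i ∧ does (lookup u i ≟F a) ⟧ * G a)
                   ≡ ⟦ free i ⟧ * G (lookup u i)
    expand i = trans
      (∑-singleF (lookup u i) (λ a a≢ → cong (λ d → ⟦ d ⟧ * G a)
        (trans (cong (free i ∧_) (does-≢ (a≢ ∘ sym))) (BoolP.∧-zeroʳ (free i)))))
      (cong (λ d → ⟦ d ⟧ * G (lookup u i))
        (trans (cong (free i ∧_) (does-refl (lookup u i))) (BoolP.∧-identityʳ (free i))))

  -- With every position free and `k = N` this is the number N of the outline; the general form is
  -- what the induction needs.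
  arrangements : (Fin N → Bool) → Word m k → (Fin m → Fin m → ℕ) → ℕ
  arrangements {k} free w E = ∑ (allVecs (allFin N) k)
    (λ σ → ⟦ admissible free σ ∧ does (realises? (Vec.map (lookup u) σ) w E) ⟧)

  arrangements-∷ : (free : Fin N → Bool) (y : Fin m) (w : Word m k) (E : Fin m → Fin m → ℕ) →
    arrangements free (y ∷ w) E ≡
    ∑ (allFin N) (λ i → ∑ (allVecs (allFin N) k) (λ σ →
      ⟦ (free i ∧ admissible (delete i free) σ) ∧
        does (realises? (lookup u i ∷ Vec.map (lookup u) σ) (y ∷ w) E) ⟧))
  arrangements-∷ {k} free y w E = trans
    (∑-concatMap (λ i → map (i ∷_) (allVecs (allFin N) k)) (allFin N) _)
    (∑-cong (allFin N) (λ i → ∑-map (i ∷_) (allVecs (allFin N) k) _))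

-- Lowering one entry of an exponent matrix.

module _ (x y : Fin m) (E : Fin m → Fin m → ℕ) where

  -- Exponents are functions here instead of `JExp`, so that one entry can be lowered pointwise. The
  -- subtraction truncates only when `E x y` is zero, a case treated separately.
  decrement : Fin m → Fin m → ℕ
  decrement a b = E a b ∸ ⟦ does (x ≟F a) ∧ does (y ≟F b) ⟧

  module _ {e : ℕ} (Exy : E x y ≡ suc e) where

    decrement-spec : ∀ a b → E a b ≡ ⟦ does (x ≟F a) ∧ does (y ≟F b) ⟧ + decrement a b
    decrement-spec a b with x ≟F a | y ≟F b
    ... | yes refl | yes refl = trans Exy (cong (λ t → suc (t ∸ 1)) (sym Exy))
    ... | yes _    | no _     = refl
    ... | no _     | _        = refl

    ∑-decrement-row : ∀ a → ∑ (allFin m) (E a) ≡ ⟦ does (x ≟F a) ⟧ + ∑ (allFin m) (decrement a)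
    ∑-decrement-row a = trans (∑-cong (allFin m) (decrement-spec a))
      (trans (∑-+ (allFin m) _ _) (cong (_+ ∑ (allFin m) (decrement a)) (∑-∧ʳ (does (x ≟F a)) y)))

    ∑-decrement-column : ∀ b → ∑ (allFin m) (λ a → E a b) ≡
      ⟦ does (y ≟F b) ⟧ + ∑ (allFin m) (λ a → decrement a b)
    ∑-decrement-column b = trans (∑-cong (allFin m) (λ a → decrement-spec a b))
      (trans (∑-+ (allFin m) _ _) (cong (_+ ∑ (allFin m) (λ a → decrement a b)) (∑-∧ˡ (does (y ≟F b)) x)))

    -- The outer `∏-update` changes only column `y`, by the factor `E x y` that the inner `∏-!-step`
    -- extracts at row `x`.
    ∏∏-!-decrement : ∏ (allFin m) (λ b → ∏ (allFin m) (λ a → E a b !)) ≡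
      E x y * ∏ (allFin m) (λ b → ∏ (allFin m) (λ a → decrement a b !))
    ∏∏-!-decrement = ∏-update (E x y) (UniqueP.allFin⁺ m) (∈P.∈-allFin y)
      (∏-!-step (λ a → trans (decrement-spec a y)
        (cong (λ d → ⟦ d ⟧ + decrement a y)
          (trans (cong (does (x ≟F a) ∧_) (does-refl y)) (BoolP.∧-identityʳ _)))))
      (λ b b≢y → ∏-cong (allFin m) (λ a → cong _! (trans (decrement-spec a b)
        (cong (λ d → ⟦ d ⟧ + decrement a b)
          (trans (cong (does (x ≟F a) ∧_) (does-≢ (b≢y ∘ sym))) (BoolP.∧-zeroʳ _))))))

    -- The leading pair adds the same indicator to `r` as `decrement` removes from `E`, so it
    -- cancels in every equation.
    realises-decrement : (v w : Word m n) →
      does (realises? (x ∷ v) (y ∷ w) E) ≡ does (realises? v w decrement)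
    realises-decrement v w = does-⇔ (mk⇔
      (λ h a b → ℕP.+-cancelˡ-≡ ⟦ does (x ≟F a) ∧ does (y ≟F b) ⟧ _ _
        (trans (sym (r-∷ a b x y v w)) (trans (h a b) (decrement-spec a b))))
      (λ h a b → trans (r-∷ a b x y v w)
        (trans (cong (⟦ does (x ≟F a) ∧ does (y ≟F b) ⟧ +_) (h a b)) (sym (decrement-spec a b)))))
      (realises? (x ∷ v) (y ∷ w) E) (realises? v w decrement)

  ¬realises-zero : E x y ≡ 0 → (v w : Word m n) → ¬ Realises (x ∷ v) (y ∷ w) E
  ¬realises-zero Exy v w h = ℕP.1+n≢0 (begin
    1 + r x y v w                                    ≡⟨ cong₂ (λ d e → ⟦ d ∧ e ⟧ + r x y v w) (does-refl x) (does-refl y) ⟨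
    ⟦ does (x ≟F x) ∧ does (y ≟F y) ⟧ + r x y v w    ≡⟨ r-∷ x y x y v w ⟨
    r x y (x ∷ v) (y ∷ w)                            ≡⟨ h x y ⟩
    E x y                                            ≡⟨ Exy ⟩
    0                                                ∎)

-- The counting identity.

f≤∑ : (f : Fin m → ℕ) (a : Fin m) → f a ≤ ∑ (allFin m) f
f≤∑ {m} f a = go (∈P.∈-allFin a)
  where
  go : ∀ {xs} → a ∈ xs → f a ≤ ∑ xs f
  go (here refl)         = ℕP.m≤m+n (f a) _
  go (there {x = x} a∈)  = ℕP.≤-trans (go a∈) (ℕP.m≤n+m _ (f x))

∑≡0⇒≡0 : (f : Fin m → ℕ) → ∑ (allFin m) f ≡ 0 → ∀ a → f a ≡ 0
∑≡0⇒≡0 f eq a = ℕP.n≤0⇒n≡0 (subst (f a ≤_) eq (f≤∑ f a))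

-- Multiplying by the entry factorials keeps the identity in `ℕ`. Both marginal hypotheses survive a
-- choice: using a free position of letter `x` against `y` lowers row `x` and column `y` of `E`
-- along with the matching letter counts. They also force exactly as many free positions as `w` has
-- letters.
arrangements-count : {N : ℕ} (u : Word m N) (w : Word m k) (free : Fin N → Bool)
  (E : Fin m → Fin m → ℕ) →
  (∀ a → freeℓ u free a ≡ ∑ (allFin m) (E a)) →
  (∀ b → ∑ (allFin m) (λ a → E a b) ≡ ℓ b w) →
  arrangements u free w E * ∏ (allFin m) (λ b → ∏ (allFin m) (λ a → E a b !))
  ≡ ∏ (allFin m) (λ b → ℓ b w !) * ∏ (allFin m) (λ a → ∑ (allFin m) (E a) !)
arrangements-count {m} u [] free E rows columns = begin
  arrangements u free [] E * ∏ (allFin m) (λ b → ∏ (allFin m) (λ a → E a b !))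
    ≡⟨ cong₂ _*_ one (∏-one (allFin m) (λ b → ∏-one (allFin m) (λ a → cong _! (E≡0 a b)))) ⟩
  1
    ≡⟨ cong₂ _*_ (∏-one (allFin m) (λ _ → refl))
         (∏-one (allFin m) (λ a → cong _! (∑-zero (allFin m) (λ _ → E≡0 a _)))) ⟨
  ∏ (allFin m) (λ b → ℓ b [] !) * ∏ (allFin m) (λ a → ∑ (allFin m) (E a) !) ∎
  where
  -- An empty `w` makes all column sums zero, hence all entries; the empty sequence is then the
  -- single arrangement.
  E≡0 : ∀ a b → E a b ≡ 0
  E≡0 a b = ∑≡0⇒≡0 (λ a → E a b) (columns b) a
  one : arrangements u free [] E ≡ 1
  one = cong (λ d → ⟦ d ⟧ + 0) (dec-true (realises? [] [] E) (λ a b → sym (E≡0 a b)))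
arrangements-count {m} {suc k} {N} u (y ∷ w) free E rows columns = begin
  arrangements u free (y ∷ w) E * P
    ≡⟨ cong (_* P) (arrangements-∷ u free y w E) ⟩
  ∑ (allFin N) term * P
    ≡⟨ ∑-*ʳ P (allFin N) term ⟨
  ∑ (allFin N) (λ i → term i * P)
    ≡⟨ ∑-cong (allFin N) term-count ⟩
  ∑ (allFin N) (λ i → ⟦ free i ⟧ * G (lookup u i))
    ≡⟨ ∑-by-letter u free G ⟩
  ∑ (allFin m) (λ a → freeℓ u free a * G a)
    -- The number of free positions with letter `a` completes the lowered row factorials, so only
    -- `E a y` still depends on `a`.
    ≡⟨ ∑-cong (allFin m) (λ a → trans (cong (_* G a) (rows a)) (absorb a (E a y) refl)) ⟩
  ∑ (allFin m) (λ a → E a y * (Q * ∏ (allFin m) (λ c → ρ c !)))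
    ≡⟨ ∑-*ʳ _ (allFin m) (λ a → E a y) ⟩
  ∑ (allFin m) (λ a → E a y) * (Q * ∏ (allFin m) (λ c → ρ c !))
    ≡⟨ cong (_* (Q * ∏ (allFin m) (λ c → ρ c !))) (columns y) ⟩
  ℓ y (y ∷ w) * (Q * ∏ (allFin m) (λ c → ρ c !))
    ≡⟨ ℕP.*-assoc (ℓ y (y ∷ w)) Q _ ⟨
  ℓ y (y ∷ w) * Q * ∏ (allFin m) (λ c → ρ c !)
    ≡⟨ cong (_* ∏ (allFin m) (λ c → ρ c !)) (∏-!-step (λ b → ℓ-∷ b y w)) ⟨
  ∏ (allFin m) (λ b → ℓ b (y ∷ w) !) * ∏ (allFin m) (λ a → ρ a !) ∎
  where
  P Q : ℕ
  P = ∏ (allFin m) (λ b → ∏ (allFin m) (λ a → E a b !))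
  Q = ∏ (allFin m) (λ b → ℓ b w !)

  -- `ρ` gives the row sums, `K a` the product of row factorials after one `a` is used, and `G a`
  -- the contribution of one free position of letter `a` once multiplied by `P`.
  ρ K G : Fin m → ℕ
  ρ a = ∑ (allFin m) (E a)
  K a = ∏ (allFin m) (λ c → (ρ c ∸ ⟦ does (a ≟F c) ⟧) !)
  G a = E a y * (Q * K a)

  rest : Fin N → Vec (Fin N) k → Bool
  rest i σ = admissible (delete i free) σ ∧
             does (realises? (lookup u i ∷ Vec.map (lookup u) σ) (y ∷ w) E)

  term : Fin N → ℕ
  term i = ∑ (allVecs (allFin N) k) (λ σ →
    ⟦ (free i ∧ admissible (delete i free) σ) ∧
      does (realises? (lookup u i ∷ Vec.map (lookup u) σ) (y ∷ w) E) ⟧)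

  -- A positive `E x y` makes `ρ x` positive, so the subtraction in `K x` is exact and yields the
  -- row sums of the lowered matrix.
  K-decrement : ∀ x {e} → E x y ≡ suc e → K x ≡ ∏ (allFin m) (λ c → ∑ (allFin m) (decrement x y E c) !)
  K-decrement x Exy = ∏-cong (allFin m) (λ c → cong _!
    (trans (cong (_∸ ⟦ does (x ≟F c) ⟧) (∑-decrement-row x y E Exy c))
           (ℕP.m+n∸m≡n ⟦ does (x ≟F c) ⟧ _)))

  -- K a truncates only if ρ a = 0; then E a y = 0 and both sides vanish.
  absorb : ∀ a e → E a y ≡ e → ρ a * G a ≡ E a y * (Q * ∏ (allFin m) (λ c → ρ c !))
  absorb a zero    Eay rewrite Eay = ℕP.*-zeroʳ (ρ a)
  absorb a (suc e) Eay = begin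
    ρ a * (E a y * (Q * K a))
      ≡⟨ shuffle (ρ a) (E a y) Q (K a) ⟩
    E a y * (Q * (ρ a * K a))
      ≡⟨ cong (λ t → E a y * (Q * (ρ a * t))) (K-decrement a Eay) ⟩
    E a y * (Q * (ρ a * ∏ (allFin m) (λ c → ∑ (allFin m) (decrement a y E c) !)))
      ≡⟨ cong (λ t → E a y * (Q * t)) (∏-!-step (∑-decrement-row a y E Eay)) ⟨
    E a y * (Q * ∏ (allFin m) (λ c → ρ c !)) ∎
    where
    shuffle : ∀ a b c d → a * (b * (c * d)) ≡ b * (c * (a * d))
    shuffle = solve-∀

  term-count : ∀ i → term i * P ≡ ⟦ free i ⟧ * G (lookup u i)
  term-count i with free i in free-i
  ... | false = cong (_* P) (∑-zero (allVecs (allFin N) k) (λ _ → refl))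
  ... | true  = trans (positive (E (lookup u i) y) refl) (sym (ℕP.*-identityˡ _))
    where
    x = lookup u i
    positive : ∀ e → E x y ≡ e → ∑ (allVecs (allFin N) k) (λ σ → ⟦ rest i σ ⟧) * P ≡ G x
    -- No sequence beginning at this position can realise `E`, and `G x` has the factor `E x y`, so
    -- both sides are zero.
    positive zero    Exy = trans
      (cong (_* P) (∑-zero (allVecs (allFin N) k) (λ {σ} _ → cong ⟦_⟧
        (trans (cong (admissible (delete i free) σ ∧_)
                 (dec-false (realises? (x ∷ Vec.map (lookup u) σ) (y ∷ w) E) (¬realises-zero x y E Exy _ w)))
               (BoolP.∧-zeroʳ _)))))
      (sym (cong (_* (Q * K x)) Exy))
    positive (suc e) Exy = begin
      ∑ (allVecs (allFin N) k) (λ σ → ⟦ rest i σ ⟧) * P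
        ≡⟨ cong₂ _*_ (∑-cong (allVecs (allFin N) k) (λ σ → cong (λ d → ⟦ admissible (delete i free) σ ∧ d ⟧)
             (realises-decrement x y E Exy (Vec.map (lookup u) σ) w))) (∏∏-!-decrement x y E Exy) ⟩
      arrangements u (delete i free) w E′ * (E x y * P′)
        ≡⟨ shuffle (arrangements u (delete i free) w E′) (E x y) P′ ⟩
      E x y * (arrangements u (delete i free) w E′ * P′)
        ≡⟨ cong (E x y *_) (arrangements-count u w (delete i free) E′ rows′ columns′) ⟩
      E x y * (Q * ∏ (allFin m) (λ c → ∑ (allFin m) (E′ c) !))
        ≡⟨ cong (λ t → E x y * (Q * t)) (K-decrement x Exy) ⟨
      E x y * (Q * K x) ∎
      where
      E′ = decrement x y E
      P′ = ∏ (allFin m) (λ b → ∏ (allFin m) (λ a → E′ a b !))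
      shuffle : ∀ a b c → a * (b * c) ≡ b * (a * c)
      shuffle = solve-∀
      -- Both sides of the old hypothesis contain the same indicator, which is cancelled.
      rows′ : ∀ a → freeℓ u (delete i free) a ≡ ∑ (allFin m) (E′ a)
      rows′ a = ℕP.+-cancelˡ-≡ ⟦ does (x ≟F a) ⟧ _ _
        (trans (sym (freeℓ-delete u free i free-i a)) (trans (rows a) (∑-decrement-row x y E Exy a)))
      columns′ : ∀ b → ∑ (allFin m) (λ a → E′ a b) ≡ ℓ b w
      columns′ b = ℕP.+-cancelˡ-≡ ⟦ does (y ≟F b) ⟧ _ _
        (trans (sym (∑-decrement-column x y E Exy b)) (trans (columns b) (ℓ-∷ b y w)))

-- Enumeration of vectors.

-- In this form the known facts on uniqueness and membership for cartesian products apply.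
allVecs-suc : (xs : List X) (n : ℕ) →
  allVecs xs (suc n) ≡ List.cartesianProductWith _∷_ xs (allVecs xs n)
allVecs-suc {X} xs n = go xs
  where
  go : (ys : List X) → concatMap (λ y → map (y ∷_) (allVecs xs n)) ys
                       ≡ List.cartesianProductWith _∷_ ys (allVecs xs n)
  go []       = refl
  go (y ∷ ys) = cong (map (y ∷_) (allVecs xs n) List.++_) (go ys)

allVecs-unique : {xs : List X} → Unique xs → ∀ n → Unique (allVecs xs n)
allVecs-unique          uniq zero    = [] ∷ []
allVecs-unique {xs = xs} uniq (suc n) = subst Unique (sym (allVecs-suc xs n))
  (UniqueP.cartesianProductWith⁺ _∷_ VecP.∷-injective uniq (allVecs-unique uniq n))

∈-allVecs : {xs : List X} (v : Vec X n) → (∀ i → lookup v i ∈ xs) → v ∈ allVecs xs n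
∈-allVecs          []      v⊆ = here refl
∈-allVecs {xs = xs} (x ∷ v) v⊆ = subst (_ ∈_) (sym (allVecs-suc xs _))
  (∈P.∈-cartesianProductWith⁺ _∷_ (v⊆ zero) (∈-allVecs v (v⊆ ∘ suc)))

allWords-unique : ∀ m n → Unique (allWords m n)
allWords-unique m = allVecs-unique (UniqueP.allFin⁺ m)

∈-allWords : (v : Word m n) → v ∈ allWords m n
∈-allWords v = ∈-allVecs v (λ i → ∈P.∈-allFin _)

-- Permutations as admissible sequences.

∧-trueˡ : ∀ {a b} → a ∧ b ≡ true → a ≡ true
∧-trueˡ {true} _ = refl

∧-trueʳ : ∀ {a b} → a ∧ b ≡ true → b ≡ true
∧-trueʳ {true} eq = eq

does-true : {P : Set} (P? : Dec P) → does P? ≡ true → P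
does-true (yes p) _ = p

LookupInjective : Vec X k → Set
LookupInjective σ = ∀ i j → lookup σ i ≡ lookup σ j → i ≡ j

-- Whatever follows `x` is drawn from `delete x free` and therefore differs from `x`.
admissible⇒ : {N : ℕ} (free : Fin N → Bool) (σ : Vec (Fin N) k) → admissible free σ ≡ true →
  LookupInjective σ × (∀ i → free (lookup σ i) ≡ true)
admissible⇒ free []      _   = (λ ()) , (λ ())
admissible⇒ {N = N} free (x ∷ σ) adm = injective , available
  where
  ih = admissible⇒ (delete x free) σ (∧-trueʳ {free x} adm)
  x∉σ : ∀ j → x ≢ lookup σ j
  x∉σ j x≡ = contradiction
    (trans (sym (∧-trueˡ (proj₂ ih j))) (cong not (dec-true (x ≟F lookup σ j) x≡))) λ ()
  injective : LookupInjective (x ∷ σ)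
  injective zero    zero    _  = refl
  injective zero    (suc j) eq = ⊥-elim (x∉σ j eq)
  injective (suc i) zero    eq = ⊥-elim (x∉σ i (sym eq))
  injective (suc i) (suc j) eq = cong suc (proj₁ ih i j eq)
  available : ∀ i → free (lookup (x ∷ σ) i) ≡ true
  available zero    = ∧-trueˡ adm
  available (suc i) = ∧-trueʳ {not (does (x ≟F lookup σ i))} (proj₂ ih i)

admissible⇐ : {N : ℕ} (free : Fin N → Bool) (σ : Vec (Fin N) k) →
  LookupInjective σ → (∀ i → free (lookup σ i) ≡ true) → admissible free σ ≡ true
admissible⇐ free []      _   _     = refl
admissible⇐ free (x ∷ σ) inj avail = cong₂ _∧_ (avail zero)
  (admissible⇐ (delete x free) σ (λ i j eq → suc-injective (inj (suc i) (suc j) eq))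
    (λ i → cong₂ _∧_ (cong not (does-≢ (λ eq → contradiction (inj zero (suc i) eq) λ ())))
                     (avail (suc i))))

isPerm-admissible : (σ : Vec (Fin n) n) → does (isPerm? σ) ≡ admissible (const true) σ
isPerm-admissible σ with admissible (const true) σ in adm
... | true  = dec-true (isPerm? σ) (proj₁ (admissible⇒ (const true) σ adm))
... | false = dec-false (isPerm? σ)
                (λ perm → contradiction (trans (sym adm) (admissible⇐ (const true) σ perm (λ _ → refl))) λ ())

-- The action of permutations on words and codes.

^-map : (u : Word m n) (σ : Vec (Fin n) n) → u ^ σ ≡ Vec.map (lookup u) σ
^-map u σ = trans (VecP.tabulate-∘ (lookup u) (lookup σ)) (cong (Vec.map (lookup u)) (VecP.tabulate∘lookup σ))

∑-Sym-realises : (u w : Word m n) (E : Fin m → Fin m → ℕ) →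
  ∑ (Sym n) (λ σ → ⟦ does (realises? (u ^ σ) w E) ⟧) ≡ arrangements u (const true) w E
∑-Sym-realises {n = n} u w E = begin
  ∑ (Sym n) (λ σ → ⟦ does (realises? (u ^ σ) w E) ⟧)
    ≡⟨ ∑-filter isPerm? (allVecs (allFin n) n) _ ⟩
  ∑ (allVecs (allFin n) n) (λ σ → ⟦ does (isPerm? σ) ⟧ * ⟦ does (realises? (u ^ σ) w E) ⟧)
    ≡⟨ ∑-cong (allVecs (allFin n) n) (λ σ → trans
         (sym (⟦∧⟧ (does (isPerm? σ)) _))
         (cong₂ (λ d v → ⟦ d ∧ does (realises? v w E) ⟧) (isPerm-admissible σ) (^-map u σ))) ⟩
  arrangements u (const true) w E ∎

-- Pigeonhole: if `j` were missed, punching it out would give an injection from `Fin (suc n)` into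
-- `Fin n`.
perm-surjective : (σ : Vec (Fin n) n) → IsPerm σ → ∀ j → ∃ λ i → lookup σ i ≡ j
perm-surjective {suc n} σ perm j with any? (λ i → lookup σ i ≟F j)
... | yes hit = hit
... | no miss = ⊥-elim (<⇒notInjective (ℕP.n<1+n n)
  (λ {a} {b} eq → perm a b (punchOut-injective (avoid a) (avoid b) eq)))
  where
  avoid : ∀ i → j ≢ lookup σ i
  avoid i eq = miss (i , sym eq)

-- Double counting of the pairs `(i , j)` with `lookup σ i ≡ j`: every `j` has a single preimage.
∑-perm : (σ : Vec (Fin n) n) → IsPerm σ → (h : Fin n → ℕ) →
  ∑ (allFin n) (λ i → h (lookup σ i)) ≡ ∑ (allFin n) h
∑-perm {n} σ perm h = begin
  ∑ (allFin n) (λ i → h (lookup σ i))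
    ≡⟨ ∑-cong (allFin n) (λ i → expand (lookup σ i)) ⟨
  ∑ (allFin n) (λ i → ∑ (allFin n) (λ j → ⟦ does (lookup σ i ≟F j) ⟧ * h j))
    ≡⟨ ∑-swap (allFin n) (allFin n) _ ⟩
  ∑ (allFin n) (λ j → ∑ (allFin n) (λ i → ⟦ does (lookup σ i ≟F j) ⟧ * h j))
    ≡⟨ ∑-cong (allFin n) (λ j → collapse j (perm-surjective σ perm j)) ⟩
  ∑ (allFin n) h ∎
  where
  expand : ∀ i → ∑ (allFin n) (λ j → ⟦ does (i ≟F j) ⟧ * h j) ≡ h i
  expand i = trans (∑-singleF i (λ j j≢i → cong (λ d → ⟦ d ⟧ * h j) (does-≢ (j≢i ∘ sym))))
    (trans (cong (λ d → ⟦ d ⟧ * h i) (does-refl i)) (ℕP.*-identityˡ (h i)))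
  collapse : ∀ j → (∃ λ i → lookup σ i ≡ j) → ∑ (allFin n) (λ i → ⟦ does (lookup σ i ≟F j) ⟧ * h j) ≡ h j
  collapse .(lookup σ i) (i , refl) = trans
    (∑-singleF i (λ k k≢i → cong (λ d → ⟦ d ⟧ * h (lookup σ i)) (does-≢ (k≢i ∘ perm k i))))
    (trans (cong (λ d → ⟦ d ⟧ * h (lookup σ i)) (does-refl (lookup σ i))) (ℕP.*-identityˡ _))

map-allFin-suc : (f : Fin (suc n) → X) → map f (allFin (suc n)) ≡ f zero ∷ map (f ∘ suc) (allFin n)
map-allFin-suc f = cong (f zero ∷_)
  (trans (ListP.map-tabulate Fin.suc f) (sym (ListP.map-tabulate id (f ∘ suc))))

∑-allFin-suc : (f : Fin (suc n) → ℕ) → ∑ (allFin (suc n)) f ≡ f zero + ∑ (allFin n) (f ∘ suc)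
∑-allFin-suc f = cong (foldr _+_ 0) (map-allFin-suc f)

freeℓ-all : (u : Word m n) (a : Fin m) → freeℓ u (const true) a ≡ ℓ a u
freeℓ-all []      a = refl
freeℓ-all (x ∷ u) a = begin
  freeℓ (x ∷ u) (const true) a                     ≡⟨ ∑-allFin-suc (λ i → ⟦ does (lookup (x ∷ u) i ≟F a) ⟧) ⟩
  ⟦ does (x ≟F a) ⟧ + freeℓ u (const true) a       ≡⟨ cong (⟦ does (x ≟F a) ⟧ +_) (freeℓ-all u a) ⟩
  ⟦ does (x ≟F a) ⟧ + ℓ a u                        ≡⟨ ℓ-∷ a x u ⟨
  ℓ a (x ∷ u)                                      ∎

ℓ-^ : (u : Word m n) (σ : Vec (Fin n) n) → IsPerm σ → ∀ a → ℓ a (u ^ σ) ≡ ℓ a u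
ℓ-^ {n = n} u σ perm a = begin
  ℓ a (u ^ σ)
    ≡⟨ freeℓ-all (u ^ σ) a ⟨
  ∑ (allFin n) (λ i → ⟦ does (lookup (u ^ σ) i ≟F a) ⟧)
    ≡⟨ ∑-cong (allFin n) (λ i → cong (λ x → ⟦ does (x ≟F a) ⟧)
         (VecP.lookup∘tabulate (λ i → lookup u (lookup σ i)) i)) ⟩
  ∑ (allFin n) (λ i → ⟦ does (lookup u (lookup σ i) ≟F a) ⟧)
    ≡⟨ ∑-perm σ perm (λ j → ⟦ does (lookup u j ≟F a) ⟧) ⟩
  ∑ (allFin n) (λ j → ⟦ does (lookup u j ≟F a) ⟧)
    ≡⟨ freeℓ-all u a ⟩
  ℓ a u ∎

^-injective : (σ : Vec (Fin n) n) → IsPerm σ → {u v : Word m n} → u ^ σ ≡ v ^ σ → u ≡ v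
^-injective σ perm {u} {v} eq = begin
  u                    ≡⟨ VecP.tabulate∘lookup u ⟨
  tabulate (lookup u)  ≡⟨ VecP.tabulate-cong (λ j → at j (perm-surjective σ perm j)) ⟩
  tabulate (lookup v)  ≡⟨ VecP.tabulate∘lookup v ⟩
  v                    ∎
  where
  at : ∀ j → (∃ λ i → lookup σ i ≡ j) → lookup u j ≡ lookup v j
  at .(lookup σ i) (i , refl) = begin
    lookup u (lookup σ i)  ≡⟨ VecP.lookup∘tabulate _ i ⟨
    lookup (u ^ σ) i       ≡⟨ cong (λ z → lookup z i) eq ⟩
    lookup (v ^ σ) i       ≡⟨ VecP.lookup∘tabulate _ i ⟩
    lookup v (lookup σ i)  ∎

-- At most one entry can satisfy `p`, so the disjunction has the same value as the sum of the
-- indicators.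
⟦any⟧ : {xs : List X} (p : X → Bool) → Unique xs →
  (∀ x y → p x ≡ true → p y ≡ true → x ≡ y) → ⟦ any p xs ⟧ ≡ ∑ xs (⟦_⟧ ∘ p)
⟦any⟧ {xs = []}     p _             _   = refl
⟦any⟧ {xs = x ∷ xs} p (x∉ ∷ uniq) one with p x in px
... | false = ⟦any⟧ p uniq one
... | true  = cong suc (sym (∑-zero xs others))
  where
  others : ∀ {y} → y ∈ xs → ⟦ p y ⟧ ≡ 0
  others {y} y∈ with p y in py
  ... | false = refl
  ... | true  = contradiction (one x y px py) (All.lookup x∉ y∈)

-- A word of `C ^C σ` has exactly one preimage in `C`, because σ acts injectively. Summing over
-- preimages instead replaces the permuted code by `C` itself.
∑-^C : (C : Code m n) (σ : Vec (Fin n) n) → IsPerm σ → (f : Word m n → ℕ) →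
  ∑ (filter (λ v → T? ((C ^C σ) v)) (allWords m n)) f ≡
  ∑ (allWords m n) (λ u → ⟦ C u ⟧ * f (u ^ σ))
∑-^C {m} {n} C σ perm f = begin
  ∑ (filter (λ v → T? ((C ^C σ) v)) W) f
    ≡⟨ ∑-filter (λ v → T? ((C ^C σ) v)) W f ⟩
  ∑ W (λ v → ⟦ (C ^C σ) v ⟧ * f v)
    ≡⟨ ∑-cong W (λ v → trans (cong (_* f v) (preimage v)) (sym (∑-*ʳ (f v) W _))) ⟩
  ∑ W (λ v → ∑ W (λ u → ⟦ C u ∧ does ((u ^ σ) ≟ v) ⟧ * f v))
    ≡⟨ ∑-swap W W _ ⟩
  ∑ W (λ u → ∑ W (λ v → ⟦ C u ∧ does ((u ^ σ) ≟ v) ⟧ * f v))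
    ≡⟨ ∑-cong W (λ u → trans (∑-single (allWords-unique m n) (∈-allWords (u ^ σ)) (off u)) (on u)) ⟩
  ∑ W (λ u → ⟦ C u ⟧ * f (u ^ σ)) ∎
  where
  W = allWords m n
  _≟_ : (u v : Word m n) → Dec (u ≡ v)
  _≟_ = VecP.≡-dec _≟F_
  preimage : ∀ v → ⟦ (C ^C σ) v ⟧ ≡ ∑ W (λ u → ⟦ C u ∧ does ((u ^ σ) ≟ v) ⟧)
  preimage v = ⟦any⟧ _ (allWords-unique m n) λ x y px py → ^-injective σ perm
    (trans (does-true ((x ^ σ) ≟ v) (∧-trueʳ {C x} px)) (sym (does-true ((y ^ σ) ≟ v) (∧-trueʳ {C y} py))))
  off : ∀ u v → v ≢ u ^ σ → ⟦ C u ∧ does ((u ^ σ) ≟ v) ⟧ * f v ≡ 0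
  off u v v≢ = cong (λ d → ⟦ d ⟧ * f v)
    (trans (cong (C u ∧_) (dec-false ((u ^ σ) ≟ v) (v≢ ∘ sym))) (BoolP.∧-zeroʳ (C u)))
  on : ∀ u → ⟦ C u ∧ does ((u ^ σ) ≟ (u ^ σ)) ⟧ * f (u ^ σ) ≡ ⟦ C u ⟧ * f (u ^ σ)
  on u = cong (λ d → ⟦ d ⟧ * f (u ^ σ))
    (trans (cong (C u ∧_) (dec-true ((u ^ σ) ≟ (u ^ σ)) refl)) (BoolP.∧-identityʳ (C u)))

-- Occurrences of an exponent in the sum over all permutations.

sum-tabulate : (f : Fin m → ℕ) → Vec.sum (tabulate f) ≡ ∑ (allFin m) f
sum-tabulate {zero}  f = refl
sum-tabulate {suc m} f = trans (cong (f zero +_) (sum-tabulate (f ∘ suc))) (sym (∑-allFin-suc f))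

length-∑ : {P : X → Set} (P? : Decidable P) (xs : List X) →
  List.length (filter P? xs) ≡ ∑ xs (λ x → ⟦ does (P? x) ⟧)
length-∑ P? []       = refl
length-∑ P? (x ∷ xs) with does (P? x)
... | true  = cong suc (length-∑ P? xs)
... | false = length-∑ P? xs

tabulate-injective : {f g : Fin n → X} → tabulate f ≡ tabulate g → ∀ i → f i ≡ g i
tabulate-injective {f = f} {g} eq i = begin
  f i                    ≡⟨ VecP.lookup∘tabulate f i ⟨
  lookup (tabulate f) i  ≡⟨ cong (λ v → lookup v i) eq ⟩
  lookup (tabulate g) i  ≡⟨ VecP.lookup∘tabulate g i ⟩
  g i                    ∎

_≟J_ : (E E′ : JExp m) → Dec (E ≡ E′)
_≟J_ = VecP.≡-dec (VecP.≡-dec ℕP._≟_)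

rvec-realises : (v w : Word m n) (E : JExp m) → does (rvec v w ≟J E) ≡ does (realises? v w (R_ E))
rvec-realises v w E = does-⇔ (mk⇔ to from) (rvec v w ≟J E) (realises? v w (R_ E))
  where
  to : rvec v w ≡ E → Realises v w (R_ E)
  to refl a b = sym (trans (cong (λ z → lookup z b) (VecP.lookup∘tabulate _ a)) (VecP.lookup∘tabulate _ b))
  from : Realises v w (R_ E) → rvec v w ≡ E
  from h = begin
    tabulate (λ a → tabulate (λ b → r a b v w))
      ≡⟨ VecP.tabulate-cong (λ a → trans (VecP.tabulate-cong (h a)) (VecP.tabulate∘lookup (lookup E a))) ⟩
    tabulate (lookup E)
      ≡⟨ VecP.tabulate∘lookup E ⟩
    E ∎

-- Spelled as in `Compatible`, which thus says by definition that `L ≡ rowSums E` and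
-- `comp w ≡ columnSums E`.
rowSums columnSums : JExp m → Vec ℕ m
rowSums    E = tabulate (λ c → Vec.sum (tabulate (λ b → (R_ E) c b)))
columnSums E = tabulate (λ c → Vec.sum (tabulate (λ b → (R_ E) b c)))

module _ (C : Code m n) (w : Word m n) (E : JExp m) where

  -- The coefficient of the exponent `E` in the sum over σ before division by n!, as a natural
  -- number.
  occurrences : ℕ
  occurrences = ∑ (Sym n) (λ σ → ∑ (filter (λ v → T? ((C ^C σ) v)) (allWords m n))
                  (λ v → ⟦ does (rvec v w ≟J E) ⟧))

  -- Once every permuted code is indexed by `C`, the sums can be exchanged; for a fixed codeword the
  -- inner sum counts suitable permutations.
  occurrences-arrangements : occurrences ≡
    ∑ (allWords m n) (λ u → ⟦ C u ⟧ * arrangements u (const true) w (R_ E))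
  occurrences-arrangements = begin
    occurrences
      ≡⟨ ∑-agree (Sym n) (λ {σ} σ∈ → ∑-^C C σ
           (proj₂ (∈P.∈-filter⁻ isPerm? {xs = allVecs (allFin n) n} σ∈)) _) ⟩
    ∑ (Sym n) (λ σ → ∑ (allWords m n) (λ u → ⟦ C u ⟧ * ⟦ does (rvec (u ^ σ) w ≟J E) ⟧))
      ≡⟨ ∑-swap (Sym n) (allWords m n) _ ⟩
    ∑ (allWords m n) (λ u → ∑ (Sym n) (λ σ → ⟦ C u ⟧ * ⟦ does (rvec (u ^ σ) w ≟J E) ⟧))
      ≡⟨ ∑-cong (allWords m n) (λ u → trans (∑-*ˡ ⟦ C u ⟧ (Sym n) _) (cong (⟦ C u ⟧ *_)
           (trans (∑-cong (Sym n) (λ σ → cong ⟦_⟧ (rvec-realises (u ^ σ) w E))) (∑-Sym-realises u w (R_ E))))) ⟩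
    ∑ (allWords m n) (λ u → ⟦ C u ⟧ * arrangements u (const true) w (R_ E)) ∎

  arrangements-zero : (u : Word m n) →
    (∀ σ → IsPerm σ → ¬ Realises (u ^ σ) w (R_ E)) → arrangements u (const true) w (R_ E) ≡ 0
  arrangements-zero u none = trans (sym (∑-Sym-realises u w (R_ E))) (∑-zero (Sym n) (λ {σ} σ∈ →
    cong ⟦_⟧ (dec-false (realises? (u ^ σ) w (R_ E))
      (none σ (proj₂ (∈P.∈-filter⁻ isPerm? {xs = allVecs (allFin n) n} σ∈))))))

  -- The column sums of any realised exponent are the letter counts of `w`, whatever the other word
  -- is.
  occurrences-zero : comp w ≢ columnSums E → occurrences ≡ 0
  occurrences-zero columns≢ = trans occurrences-arrangements (∑-zero (allWords m n) (λ {u} _ →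
    trans (cong (⟦ C u ⟧ *_) (arrangements-zero u (λ σ _ h → columns≢ (VecP.tabulate-cong (λ b → begin
      ℓ b w                                     ≡⟨ ∑-r-column (u ^ σ) w b ⟨
      ∑ (allFin m) (λ a → r a b (u ^ σ) w)      ≡⟨ ∑-cong (allFin m) (λ a → h a b) ⟩
      ∑ (allFin m) (λ a → (R_ E) a b)           ≡⟨ sum-tabulate (λ a → (R_ E) a b) ⟨
      Vec.sum (tabulate (λ a → (R_ E) a b))     ∎)))))
    (ℕP.*-zeroʳ ⟦ C u ⟧)))

  entryFactorials columnFactorials rowFactorials : ℕ
  entryFactorials  = ∏ (allFin m) (λ b → ∏ (allFin m) (λ a → (R_ E) a b !))
  columnFactorials = ∏ (allFin m) (λ b → ℓ b w !)
  rowFactorials    = ∏ (allFin m) (λ a → ∑ (allFin m) ((R_ E) a) !)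

  -- Every codeword with composition `rowSums E` contributes the same amount, given by
  -- `arrangements-count`; all others contribute nothing.
  occurrences-count : comp w ≡ columnSums E →
    occurrences * entryFactorials ≡ A C (rowSums E) * (columnFactorials * rowFactorials)
  occurrences-count columns≡ = begin
    occurrences * entryFactorials
      ≡⟨ cong (_* entryFactorials) occurrences-arrangements ⟩
    ∑ (allWords m n) (λ u → ⟦ C u ⟧ * arrangements u (const true) w (R_ E)) * entryFactorials
      ≡⟨ ∑-*ʳ entryFactorials (allWords m n) _ ⟨
    ∑ (allWords m n) (λ u → ⟦ C u ⟧ * arrangements u (const true) w (R_ E) * entryFactorials)
      ≡⟨ ∑-cong (allWords m n) term ⟩
    ∑ (allWords m n) (λ u → ⟦ C u ∧ does (comp u ≟V rowSums E) ⟧ * (columnFactorials * rowFactorials))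
      ≡⟨ ∑-*ʳ (columnFactorials * rowFactorials) (allWords m n) _ ⟩
    ∑ (allWords m n) (λ u → ⟦ C u ∧ does (comp u ≟V rowSums E) ⟧) * (columnFactorials * rowFactorials)
      ≡⟨ cong (_* (columnFactorials * rowFactorials))
           (length-∑ (λ u → T? (C u) ×-dec (comp u ≟V rowSums E)) (allWords m n)) ⟨
    A C (rowSums E) * (columnFactorials * rowFactorials) ∎
    where
    _≟V_ : (L L′ : Vec ℕ m) → Dec (L ≡ L′)
    _≟V_ = VecP.≡-dec ℕP._≟_
    columns : ∀ b → ∑ (allFin m) (λ a → (R_ E) a b) ≡ ℓ b w
    columns b = trans (sym (sum-tabulate (λ a → (R_ E) a b))) (sym (tabulate-injective columns≡ b))
    term : ∀ u → ⟦ C u ⟧ * arrangements u (const true) w (R_ E) * entryFactorials ≡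
                 ⟦ C u ∧ does (comp u ≟V rowSums E) ⟧ * (columnFactorials * rowFactorials)
    term u with comp u ≟V rowSums E
    ... | yes rows≡ = trans (ℕP.*-assoc ⟦ C u ⟧ _ entryFactorials)
      (cong₂ _*_ (cong ⟦_⟧ (sym (BoolP.∧-identityʳ (C u))))
        (arrangements-count u w (const true) (R_ E)
          (λ a → trans (freeℓ-all u a) (trans (tabulate-injective rows≡ a) (sum-tabulate ((R_ E) a))))
          columns))
    ... | no rows≢ = begin
      ⟦ C u ⟧ * arrangements u (const true) w (R_ E) * entryFactorials
        -- Permuting keeps the letter counts of `u`, so a realised `E` would have `comp u` as its
        -- row sums.
        ≡⟨ cong (λ t → ⟦ C u ⟧ * t * entryFactorials) (arrangements-zero u λ σ perm h →
             rows≢ (VecP.tabulate-cong (λ a → begin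
               ℓ a u                                    ≡⟨ ℓ-^ u σ perm a ⟨
               ℓ a (u ^ σ)                              ≡⟨ ∑-r-row (u ^ σ) w a ⟨
               ∑ (allFin m) (λ b → r a b (u ^ σ) w)     ≡⟨ ∑-cong (allFin m) (h a) ⟩
               ∑ (allFin m) ((R_ E) a)                  ≡⟨ sum-tabulate ((R_ E) a) ⟨
               Vec.sum (tabulate ((R_ E) a))            ∎))) ⟩
      ⟦ C u ⟧ * 0 * entryFactorials
        ≡⟨ cong (_* entryFactorials) (ℕP.*-zeroʳ ⟦ C u ⟧) ⟩
      0
        ≡⟨ cong (λ d → ⟦ d ⟧ * (columnFactorials * rowFactorials)) (BoolP.∧-zeroʳ (C u)) ⟨
      ⟦ C u ∧ false ⟧ * (columnFactorials * rowFactorials) ∎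

-- Natural numbers inside the rationals.

module ℚ∑ = ListSum (IsCommutativeRing.isCommutativeSemiring ℚP.+-*-isCommutativeRing)

ι : ℕ → ℚ
ι a = ℤ.+ a / 1

toℚᵘ-/ : ∀ a b → ℚ.toℚᵘ (ℤ.+ a / suc b) ℚᵘ.≃ mkℚᵘ (ℤ.+ a) b
toℚᵘ-/ a b = ℚP.toℚᵘ-fromℚᵘ (mkℚᵘ (ℤ.+ a) b)

-- Among unnormalised rationals equality is cross multiplication of integers, so reduction to lowest
-- terms does not interfere. `ι-+` and `ι-*` take the same route.
/-*-cancel : ∀ a b .{{_ : NonZero b}} → (ℤ.+ a / b) ℚ.* ι b ≡ ι a
/-*-cancel a (suc b) = ℚP.toℚᵘ-injective (ℚᵘP.≃-trans
  (ℚP.toℚᵘ-homo-* (ℤ.+ a / suc b) (ι (suc b)))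
  (ℚᵘP.≃-trans (ℚᵘP.*-cong (toℚᵘ-/ a b) (toℚᵘ-/ (suc b) 0))
  (ℚᵘP.≃-trans (*≡* cross) (ℚᵘP.≃-sym (toℚᵘ-/ a 0)))))
  where
  cross : (ℤ.+ a ℤ.* ℤ.+ suc b) ℤ.* ℤ.+ 1 ≡ ℤ.+ a ℤ.* ℤ.+ (suc b * 1)
  cross = trans (ℤP.*-identityʳ _) (cong (λ t → ℤ.+ a ℤ.* ℤ.+ t) (sym (ℕP.*-identityʳ (suc b))))

ι-+ : ∀ a b → ι (a + b) ≡ ι a ℚ.+ ι b
ι-+ a b = ℚP.toℚᵘ-injective (ℚᵘP.≃-trans (toℚᵘ-/ (a + b) 0) (ℚᵘP.≃-trans (*≡* cross)
  (ℚᵘP.≃-trans (ℚᵘP.≃-sym (ℚᵘP.+-cong (toℚᵘ-/ a 0) (toℚᵘ-/ b 0)))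
               (ℚᵘP.≃-sym (ℚP.toℚᵘ-homo-+ (ι a) (ι b))))))
  where
  cross : ℤ.+ (a + b) ℤ.* ℤ.+ 1 ≡ (ℤ.+ a ℤ.* ℤ.+ 1 ℤ.+ ℤ.+ b ℤ.* ℤ.+ 1) ℤ.* ℤ.+ 1
  cross = cong (ℤ._* ℤ.+ 1) (sym (cong₂ ℤ._+_ (ℤP.*-identityʳ (ℤ.+ a)) (ℤP.*-identityʳ (ℤ.+ b))))

ι-* : ∀ a b → ι (a * b) ≡ ι a ℚ.* ι b
ι-* a b = ℚP.toℚᵘ-injective (ℚᵘP.≃-trans (toℚᵘ-/ (a * b) 0) (ℚᵘP.≃-trans (*≡* cross)
  (ℚᵘP.≃-trans (ℚᵘP.≃-sym (ℚᵘP.*-cong (toℚᵘ-/ a 0) (toℚᵘ-/ b 0)))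
               (ℚᵘP.≃-sym (ℚP.toℚᵘ-homo-* (ι a) (ι b))))))
  where
  cross : ℤ.+ (a * b) ℤ.* ℤ.+ 1 ≡ (ℤ.+ a ℤ.* ℤ.+ b) ℤ.* ℤ.+ 1
  cross = cong (ℤ._* ℤ.+ 1) (ℤP.pos-* a b)

ι-nonZero : ∀ a .{{_ : NonZero a}} → ℚ.NonZero (ι a)
ι-nonZero a = ℚP.pos⇒nonZero (ι a) {{ℚP.normalize-pos a 1}}

ι-∑ : (xs : List X) (f : X → ℕ) → ι (∑ xs f) ≡ ℚ∑.∑ xs (ι ∘ f)
ι-∑ []       f = refl
ι-∑ (x ∷ xs) f = trans (ι-+ (f x) _) (cong (ι (f x) ℚ.+_) (ι-∑ xs f))

-- Applied with multinomials as `p`, this clears all their denominators together.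
ι-∏ : (xs : List X) (p : X → ℚ) (f g : X → ℕ) → (∀ x → p x ℚ.* ι (f x) ≡ ι (g x)) →
  foldr ℚ._*_ 1ℚ (map p xs) ℚ.* ι (∏ xs f) ≡ ι (∏ xs g)
ι-∏ []       p f g eq = refl
ι-∏ (x ∷ xs) p f g eq = begin
  (p x ℚ.* P) ℚ.* ι (f x * ∏ xs f)             ≡⟨ cong ((p x ℚ.* P) ℚ.*_) (ι-* (f x) _) ⟩
  (p x ℚ.* P) ℚ.* (ι (f x) ℚ.* ι (∏ xs f))     ≡⟨ exchange (p x) P (ι (f x)) (ι (∏ xs f)) ⟩
  (p x ℚ.* ι (f x)) ℚ.* (P ℚ.* ι (∏ xs f))     ≡⟨ cong₂ ℚ._*_ (eq x) (ι-∏ xs p f g eq) ⟩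
  ι (g x) ℚ.* ι (∏ xs g)                       ≡⟨ ι-* (g x) _ ⟨
  ι (g x * ∏ xs g)                             ∎
  where
  P = foldr ℚ._*_ 1ℚ (map p xs)
  exchange : ∀ a b c d → (a ℚ.* b) ℚ.* (c ℚ.* d) ≡ (a ℚ.* c) ℚ.* (b ℚ.* d)
  exchange = solve 4 (λ a b c d → (a :* b) :* (c :* d) := (a :* c) :* (b :* d)) refl
    where open +-*-Solver

*-cancelʳ : ∀ p q s .{{_ : ℚ.NonZero s}} → p ℚ.* s ≡ q ℚ.* s → p ≡ q
*-cancelʳ p q s eq = trans (sym (divide p)) (trans (cong (ℚ._* 1/ s) eq) (divide q))
  where
  divide : ∀ t → (t ℚ.* s) ℚ.* 1/ s ≡ t
  divide t = trans (ℚP.*-assoc t s (1/ s))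
    (trans (cong (t ℚ.*_) (ℚP.*-inverseʳ s)) (ℚP.*-identityʳ t))

prodFact-tabulate : (f : Fin m → ℕ) → prodFact (tabulate f) ≡ ∏ (allFin m) (λ i → f i !)
prodFact-tabulate {zero}  f = refl
prodFact-tabulate {suc m} f = trans (cong (f zero ! *_) (prodFact-tabulate (f ∘ suc)))
  (cong (foldr _*_ 1) (sym (map-allFin-suc (λ i → f i !))))

multinomial-* : ∀ M (f : Fin m → ℕ) → multinomial M (tabulate f) ℚ.* ι (∏ (allFin m) (λ i → f i !)) ≡ ι (M !)
multinomial-* M f = trans
  (cong (λ t → multinomial M (tabulate f) ℚ.* ι t) (sym (prodFact-tabulate f)))
  (/-*-cancel (M !) (prodFact (tabulate f)) {{prodFact≢0 (tabulate f)}})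

-- Coefficients of the average Jacobi polynomial.

coeff-∑ : (p : Poly m) (E : JExp m) → coeff p E ≡ ℚ∑.∑ p (λ t → ℚ∑.⟦ does (proj₂ t ≟J E) ⟧ ℚ.* proj₁ t)
coeff-∑ p E = ℚ∑.∑-filter (λ t → proj₂ t ≟J E) p proj₁

coeff-scale : (c : ℚ) (p : Poly m) (E : JExp m) → coeff (scale c p) E ≡ c ℚ.* coeff p E
coeff-scale c p E = begin
  coeff (scale c p) E
    ≡⟨ coeff-∑ (scale c p) E ⟩
  ℚ∑.∑ (scale c p) (λ t → ℚ∑.⟦ does (proj₂ t ≟J E) ⟧ ℚ.* proj₁ t)
    ≡⟨ ℚ∑.∑-map _ p _ ⟩
  ℚ∑.∑ p (λ t → ℚ∑.⟦ does (proj₂ t ≟J E) ⟧ ℚ.* (c ℚ.* proj₁ t))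
    ≡⟨ ℚ∑.∑-cong p (λ t → exchange ℚ∑.⟦ does (proj₂ t ≟J E) ⟧ c (proj₁ t)) ⟩
  ℚ∑.∑ p (λ t → c ℚ.* (ℚ∑.⟦ does (proj₂ t ≟J E) ⟧ ℚ.* proj₁ t))
    ≡⟨ ℚ∑.∑-*ˡ c p _ ⟩
  c ℚ.* ℚ∑.∑ p (λ t → ℚ∑.⟦ does (proj₂ t ≟J E) ⟧ ℚ.* proj₁ t)
    ≡⟨ cong (c ℚ.*_) (coeff-∑ p E) ⟨
  c ℚ.* coeff p E ∎
  where
  exchange : ∀ a b c → a ℚ.* (b ℚ.* c) ≡ b ℚ.* (a ℚ.* c)
  exchange = solve 3 (λ a b c → a :* (b :* c) := b :* (a :* c)) refl
    where open +-*-Solver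

coeff-concatMap : (g : X → Poly m) (xs : List X) (E : JExp m) →
  coeff (concatMap g xs) E ≡ ℚ∑.∑ xs (λ x → coeff (g x) E)
coeff-concatMap g xs E = trans (coeff-∑ (concatMap g xs) E)
  (trans (ℚ∑.∑-concatMap g xs _) (ℚ∑.∑-cong xs (λ x → sym (coeff-∑ (g x) E))))

coeff-Jac : (C : Code m n) (w : Word m n) (E : JExp m) → coeff (Jac C w) E ≡
  ι (∑ (filter (λ v → T? (C v)) (allWords m n)) (λ v → ⟦ does (rvec v w ≟J E) ⟧))
coeff-Jac {m} {n} C w E = begin
  coeff (Jac C w) E
    ≡⟨ coeff-∑ (Jac C w) E ⟩
  ℚ∑.∑ (Jac C w) (λ t → ℚ∑.⟦ does (proj₂ t ≟J E) ⟧ ℚ.* proj₁ t)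
    ≡⟨ ℚ∑.∑-map _ codewords _ ⟩
  ℚ∑.∑ codewords (λ v → ℚ∑.⟦ does (rvec v w ≟J E) ⟧ ℚ.* 1ℚ)
    ≡⟨ ℚ∑.∑-cong codewords (λ v → indicator (does (rvec v w ≟J E))) ⟩
  ℚ∑.∑ codewords (λ v → ι ⟦ does (rvec v w ≟J E) ⟧)
    ≡⟨ ι-∑ codewords _ ⟨
  ι (∑ codewords (λ v → ⟦ does (rvec v w ≟J E) ⟧)) ∎
  where
  codewords = filter (λ v → T? (C v)) (allWords m n)
  indicator : ∀ b → ℚ∑.⟦ b ⟧ ℚ.* 1ℚ ≡ ι ⟦ b ⟧
  indicator true  = refl
  indicator false = refl

coeff-Jacav : (C : Code m n) (w : Word m n) (E : JExp m) →
  coeff (Jacav C w) E ℚ.* ι (n !) ≡ ι (occurrences C w E)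
coeff-Jacav {n = n} C w E = begin
  coeff (Jacav C w) E ℚ.* ι (n !)
    ≡⟨ cong (ℚ._* ι (n !)) (trans (coeff-scale c (concatMap (λ σ → Jac (C ^C σ) w) (Sym n)) E) (cong (c ℚ.*_) total)) ⟩
  (c ℚ.* ι (occurrences C w E)) ℚ.* ι (n !)
    ≡⟨ rotate c (ι (occurrences C w E)) (ι (n !)) ⟩
  (c ℚ.* ι (n !)) ℚ.* ι (occurrences C w E)
    ≡⟨ cong (ℚ._* ι (occurrences C w E)) (/-*-cancel 1 (n !) {{ℕP._!≢0 n}}) ⟩
  1ℚ ℚ.* ι (occurrences C w E)
    ≡⟨ ℚP.*-identityˡ _ ⟩
  ι (occurrences C w E) ∎
  where
  c : ℚ
  c = (ℤ.+ 1 / (n !)) {{ℕP._!≢0 n}}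
  total : coeff (concatMap (λ σ → Jac (C ^C σ) w) (Sym n)) E ≡ ι (occurrences C w E)
  total = trans (coeff-concatMap (λ σ → Jac (C ^C σ) w) (Sym n) E)
    (trans (ℚ∑.∑-cong (Sym n) (λ σ → coeff-Jac (C ^C σ) w E)) (sym (ι-∑ (Sym n) _)))
  rotate : ∀ a b c → (a ℚ.* b) ℚ.* c ≡ (a ℚ.* c) ℚ.* b
  rotate = solve 3 (λ a b c → (a :* b) :* c := (a :* c) :* b) refl
    where open +-*-Solver

-- Coefficients of the right-hand side and the comparison.

∏-nonZero : (xs : List X) {f : X → ℕ} → (∀ x → NonZero (f x)) → NonZero (∏ xs f)
∏-nonZero []       f≢0 = _
∏-nonZero (x ∷ xs) f≢0 = ℕP.m*n≢0 _ _ {{f≢0 x}} {{∏-nonZero xs f≢0}}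

sum-lookup : (v : Vec ℕ k) → Vec.sum v ≡ ∑ (allFin k) (lookup v)
sum-lookup v = trans (cong Vec.sum (sym (VecP.tabulate∘lookup v))) (sum-tabulate (lookup v))

Compositions-unique : ∀ m n → Unique (Compositions m n)
Compositions-unique m n =
  UniqueP.filter⁺ (λ L → Vec.sum L ℕP.≟ n) (allVecs-unique (UniqueP.upTo⁺ (suc n)) m)

JacobiCompositions-unique : ∀ m n → Unique (JacobiCompositions m n)
JacobiCompositions-unique m n = UniqueP.filter⁺ (λ R → Vec.sum (Vec.map Vec.sum R) ℕP.≟ n)
  (allVecs-unique (allVecs-unique (UniqueP.upTo⁺ (suc n)) m) m)

∈-Compositions : (f : Fin m → ℕ) → ∑ (allFin m) f ≡ n → tabulate f ∈ Compositions m n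
∈-Compositions {n = n} f total = ∈P.∈-filter⁺ (λ L → Vec.sum L ℕP.≟ n)
  -- An entry may equal `n` itself, hence the range `upTo (suc n)`.
  (∈-allVecs (tabulate f) (λ i → ∈P.∈-upTo⁺ (s≤s (entry≤n i))))
  (trans (sum-tabulate f) total)
  where
  entry≤n : ∀ i → lookup (tabulate f) i ≤ n
  entry≤n i = subst₂ _≤_ (sym (VecP.lookup∘tabulate f i)) total (f≤∑ f i)

∈-JacobiCompositions : (E : JExp m) → ∑ (allFin m) (λ a → ∑ (allFin m) ((R_ E) a)) ≡ n →
  E ∈ JacobiCompositions m n
∈-JacobiCompositions {m} {n} E total = ∈P.∈-filter⁺ (λ R → Vec.sum (Vec.map Vec.sum R) ℕP.≟ n)
  (∈-allVecs E (λ a → ∈-allVecs (lookup E a) (λ b → ∈P.∈-upTo⁺ (s≤s (entry≤n a b)))))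
  (begin
    Vec.sum (Vec.map Vec.sum E)
      ≡⟨ sum-lookup (Vec.map Vec.sum E) ⟩
    ∑ (allFin m) (lookup (Vec.map Vec.sum E))
      ≡⟨ ∑-cong (allFin m) (λ a → trans (VecP.lookup-map a Vec.sum E) (sum-lookup (lookup E a))) ⟩
    ∑ (allFin m) (λ a → ∑ (allFin m) ((R_ E) a))
      ≡⟨ total ⟩
    n ∎)
  where
  entry≤n : ∀ a b → (R_ E) a b ≤ n
  entry≤n a b = ℕP.≤-trans (f≤∑ ((R_ E) a) b)
    (subst (∑ (allFin m) ((R_ E) a) ≤_) total (f≤∑ (λ a → ∑ (allFin m) ((R_ E) a)) a))

module _ (C : Code m n) (w : Word m n) (E : JExp m) where

  -- Both filters are turned into indicators, so the sum runs over the full enumerations and can be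
  -- collapsed one variable at a time.
  RHS-term : Vec ℕ m → JExp m → ℚ
  RHS-term L R = ℚ∑.⟦ does (compatible? w L R) ⟧ ℚ.* (ℚ∑.⟦ does (R ≟J E) ⟧ ℚ.* rhsCoeff C w L R)

  coeff-RHS : coeff (RHS C w) E ≡
    ℚ∑.∑ (Compositions m n) (λ L → ℚ∑.∑ (JacobiCompositions m n) (RHS-term L))
  coeff-RHS = trans (coeff-concatMap terms (Compositions m n) E)
    (ℚ∑.∑-cong (Compositions m n) (λ L → begin
      coeff (terms L) E
        ≡⟨ coeff-∑ (terms L) E ⟩
      ℚ∑.∑ (terms L) (λ t → ℚ∑.⟦ does (proj₂ t ≟J E) ⟧ ℚ.* proj₁ t)
        ≡⟨ ℚ∑.∑-map _ (filter (compatible? w L) (JacobiCompositions m n)) _ ⟩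
      ℚ∑.∑ (filter (compatible? w L) (JacobiCompositions m n))
           (λ R → ℚ∑.⟦ does (R ≟J E) ⟧ ℚ.* rhsCoeff C w L R)
        ≡⟨ ℚ∑.∑-filter (compatible? w L) (JacobiCompositions m n) _ ⟩
      ℚ∑.∑ (JacobiCompositions m n) (RHS-term L) ∎))
    where
    terms : Vec ℕ m → Poly m
    terms L = map (λ R → (rhsCoeff C w L R , R)) (filter (compatible? w L) (JacobiCompositions m n))

  RHS-term-incompatible : ∀ L R → ¬ (Compatible w L R × R ≡ E) → RHS-term L R ≡ 0ℚ
  RHS-term-incompatible L R ¬both = helper (compatible? w L R) (R ≟J E)
    where
    helper : (p? : Dec (Compatible w L R)) (q? : Dec (R ≡ E)) →
      ℚ∑.⟦ does p? ⟧ ℚ.* (ℚ∑.⟦ does q? ⟧ ℚ.* rhsCoeff C w L R) ≡ 0ℚ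
    helper (yes p) (yes q) = ⊥-elim (¬both (p , q))
    helper (yes _) (no _)  = trans (ℚP.*-identityˡ _) (ℚP.*-zeroˡ (rhsCoeff C w L R))
    helper (no _)  q?      = ℚP.*-zeroˡ (ℚ∑.⟦ does q? ⟧ ℚ.* rhsCoeff C w L R)

  coeff-RHS-zero : comp w ≢ columnSums E → coeff (RHS C w) E ≡ 0ℚ
  coeff-RHS-zero columns≢ = trans coeff-RHS (ℚ∑.∑-zero (Compositions m n) (λ {L} _ →
    ℚ∑.∑-zero (JacobiCompositions m n) (λ {R} _ →
      RHS-term-incompatible L R (λ { ((_ , columns≡) , refl) → columns≢ columns≡ }))))

  -- Extracting the coefficient fixes `R` as `E`, and compatibility then fixes `L` as `rowSums E`.
  -- Both occur exactly once in their enumerations.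
  coeff-RHS-single : comp w ≡ columnSums E → coeff (RHS C w) E ≡ rhsCoeff C w (rowSums E) E
  coeff-RHS-single columns≡ = begin
    coeff (RHS C w) E
      ≡⟨ coeff-RHS ⟩
    ℚ∑.∑ (Compositions m n) (λ L → ℚ∑.∑ (JacobiCompositions m n) (RHS-term L))
      ≡⟨ ℚ∑.∑-cong (Compositions m n) (λ L →
           ℚ∑.∑-single (JacobiCompositions-unique m n) (∈-JacobiCompositions E total)
             (λ R R≢E → RHS-term-incompatible L R (R≢E ∘ proj₂))) ⟩
    ℚ∑.∑ (Compositions m n) (λ L → RHS-term L E)
      ≡⟨ ℚ∑.∑-single (Compositions-unique m n) rowSums∈
           (λ L L≢ → RHS-term-incompatible L E (L≢ ∘ proj₁ ∘ proj₁)) ⟩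
    RHS-term (rowSums E) E
      ≡⟨ cong₂ (λ d e → ℚ∑.⟦ d ⟧ ℚ.* (ℚ∑.⟦ e ⟧ ℚ.* rhsCoeff C w (rowSums E) E))
           (dec-true (compatible? w (rowSums E) E) (refl , columns≡)) (dec-true (E ≟J E) refl) ⟩
    1ℚ ℚ.* (1ℚ ℚ.* rhsCoeff C w (rowSums E) E)
      ≡⟨ trans (ℚP.*-identityˡ _) (ℚP.*-identityˡ _) ⟩
    rhsCoeff C w (rowSums E) E ∎
    where
    -- The entries are added up by columns, where the hypothesis gives the letter counts of `w`;
    -- this puts `E` and `rowSums E` in the enumerations.
    total : ∑ (allFin m) (λ a → ∑ (allFin m) ((R_ E) a)) ≡ n
    total = begin
      ∑ (allFin m) (λ a → ∑ (allFin m) ((R_ E) a))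
        ≡⟨ ∑-swap (allFin m) (allFin m) (R_ E) ⟩
      ∑ (allFin m) (λ b → ∑ (allFin m) (λ a → (R_ E) a b))
        ≡⟨ ∑-cong (allFin m) (λ b → trans (sym (sum-tabulate (λ a → (R_ E) a b)))
                                          (sym (tabulate-injective columns≡ b))) ⟩
      ∑ (allFin m) (λ b → ℓ b w)
        ≡⟨ ∑-ℓ w ⟩
      n ∎
    rowSums∈ : rowSums E ∈ Compositions m n
    rowSums∈ = ∈-Compositions _
      (trans (∑-cong (allFin m) (λ a → sum-tabulate ((R_ E) a))) total)

  -- The entry factorials turn the product of multinomials into column factorials. Writing n! as
  -- `μ ℚ.* ρ` cancels the inverse multinomial and leaves the row factorials.
  rhsCoeff-* : rhsCoeff C w (rowSums E) E ℚ.* ι (entryFactorials C w E * n !) ≡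
    ι (A C (rowSums E) * (columnFactorials C w E * rowFactorials C w E))
  rhsCoeff-* = begin
    (α ℚ.* π ℚ.* μ⁻¹) ℚ.* ι (entryFactorials C w E * n !)
      ≡⟨ cong ((α ℚ.* π ℚ.* μ⁻¹) ℚ.*_)
           (trans (ι-* (entryFactorials C w E) (n !)) (cong (ε ℚ.*_) (sym μρ))) ⟩
    (α ℚ.* π ℚ.* μ⁻¹) ℚ.* (ε ℚ.* (μ ℚ.* ρ))
      ≡⟨ rearrange α π μ⁻¹ ε μ ρ ⟩
    (μ⁻¹ ℚ.* μ) ℚ.* (α ℚ.* ((π ℚ.* ε) ℚ.* ρ))
      ≡⟨ cong₂ (λ s t → s ℚ.* (α ℚ.* (t ℚ.* ρ))) (ℚP.*-inverseˡ μ {{μ≢0}}) πε ⟩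
    1ℚ ℚ.* (α ℚ.* (ι (columnFactorials C w E) ℚ.* ρ))
      ≡⟨ ℚP.*-identityˡ _ ⟩
    α ℚ.* (ι (columnFactorials C w E) ℚ.* ρ)
      ≡⟨ trans (ι-* (A C (rowSums E)) _) (cong (α ℚ.*_) (ι-* (columnFactorials C w E) _)) ⟨
    ι (A C (rowSums E) * (columnFactorials C w E * rowFactorials C w E)) ∎
    where
    α π μ μ⁻¹ ε ρ : ℚ
    α = ι (A C (rowSums E))
    π = prodℚ (λ b → multinomial (ℓ b w) (tabulate (λ a → (R_ E) a b)))
    μ = multinomial n (rowSums E)
    μ≢0 : ℚ.NonZero μ
    μ≢0 = multinomial≢0 n (rowSums E)
    μ⁻¹ = (1/ μ) {{μ≢0}}
    ε = ι (entryFactorials C w E)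
    ρ = ι (rowFactorials C w E)
    μρ : μ ℚ.* ρ ≡ ι (n !)
    μρ = trans
      (cong (λ t → μ ℚ.* ι t) (∏-cong (allFin m) (λ a → cong _! (sym (sum-tabulate ((R_ E) a))))))
      (multinomial-* n (λ c → Vec.sum (tabulate ((R_ E) c))))
    πε : π ℚ.* ε ≡ ι (columnFactorials C w E)
    πε = ι-∏ (allFin m) _ _ _ (λ b → multinomial-* (ℓ b w) (λ a → (R_ E) a b))
    rearrange : ∀ a b c d e f →
      ((a ℚ.* b) ℚ.* c) ℚ.* (d ℚ.* (e ℚ.* f)) ≡ (c ℚ.* e) ℚ.* (a ℚ.* ((b ℚ.* d) ℚ.* f))
    rearrange = solve 6 (λ a b c d e f →
      ((a :* b) :* c) :* (d :* (e :* f)) := (c :* e) :* (a :* ((b :* d) :* f))) refl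
      where open +-*-Solver

  -- Both coefficients vanish if the column sums of `E` are not the letter counts of `w`. Otherwise
  -- they agree after multiplication by a nonzero number.
  coeff-Jacav-RHS : Dec (comp w ≡ columnSums E) → coeff (Jacav C w) E ≡ coeff (RHS C w) E
  coeff-Jacav-RHS (no columns≢) = *-cancelʳ (coeff (Jacav C w) E) (coeff (RHS C w) E)
    (ι (n !)) {{ι-nonZero (n !) {{ℕP._!≢0 n}}}} (begin
    coeff (Jacav C w) E ℚ.* ι (n !)    ≡⟨ coeff-Jacav C w E ⟩
    ι (occurrences C w E)              ≡⟨ cong ι (occurrences-zero C w E columns≢) ⟩
    0ℚ                                 ≡⟨ ℚP.*-zeroˡ (ι (n !)) ⟨
    0ℚ ℚ.* ι (n !)                     ≡⟨ cong (ℚ._* ι (n !)) (coeff-RHS-zero columns≢) ⟨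
    coeff (RHS C w) E ℚ.* ι (n !)      ∎)
  coeff-Jacav-RHS (yes columns≡) = *-cancelʳ (coeff (Jacav C w) E) (coeff (RHS C w) E)
    -- On the left n! undoes the averaging and `ε` prepares for `occurrences-count`; on the right
    -- the same two factors clear the multinomials.
    (ι (ε * n !)) {{ι-nonZero (ε * n !) {{ε*n!≢0}}}} (begin
    coeff (Jacav C w) E ℚ.* ι (ε * n !)
      ≡⟨ cong (coeff (Jacav C w) E ℚ.*_) (trans (cong ι (ℕP.*-comm ε (n !))) (ι-* (n !) ε)) ⟩
    coeff (Jacav C w) E ℚ.* (ι (n !) ℚ.* ι ε)
      ≡⟨ ℚP.*-assoc (coeff (Jacav C w) E) (ι (n !)) (ι ε) ⟨
    (coeff (Jacav C w) E ℚ.* ι (n !)) ℚ.* ι ε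
      ≡⟨ cong (ℚ._* ι ε) (coeff-Jacav C w E) ⟩
    ι (occurrences C w E) ℚ.* ι ε
      ≡⟨ ι-* (occurrences C w E) ε ⟨
    ι (occurrences C w E * ε)
      ≡⟨ cong ι (occurrences-count C w E columns≡) ⟩
    ι (A C (rowSums E) * (columnFactorials C w E * rowFactorials C w E))
      ≡⟨ rhsCoeff-* ⟨
    rhsCoeff C w (rowSums E) E ℚ.* ι (ε * n !)
      ≡⟨ cong (ℚ._* ι (ε * n !)) (coeff-RHS-single columns≡) ⟨
    coeff (RHS C w) E ℚ.* ι (ε * n !) ∎)
    where
    ε = entryFactorials C w E
    ε*n!≢0 : NonZero (ε * n !)
    ε*n!≢0 = ℕP.m*n≢0 ε (n !)
      {{∏-nonZero (allFin m) (λ b → ∏-nonZero (allFin m) (λ a → ℕP._!≢0 ((R_ E) a b)))}} {{ℕP._!≢0 n}}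

theorem4p2 : (𝔄 : Alphabet) (n : ℕ) (C : Code (size 𝔄) n) → IsLinear 𝔄 n C →
  (w : Word (size 𝔄) n) → Jacav C w ≈P RHS C w
theorem4p2 𝔄 n C _ w E = coeff-Jacav-RHS C w E
  (VecP.≡-dec ℕP._≟_ (comp w) (columnSums E))
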